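{- For every integer $k\ge 3$, $\mathcal{C}_2(2k,k,2)\le 2^{2k}+6(2^k-1)$.
   Context: A $q$-covering design $\mathcal{C}_q(n,k,r)$ is a collection of $k$-dimensional subspaces of $\mathbb{F}_q^n$ such that every $r$-dimensional subspace of $\mathbb{F}_q^n$ is contained in at least one member; $\mathcal{C}_q(n,k,r)$ denotes the minimum size of such a collection. -}

module Defs where

open import Data.Bool.Base using (Bool; false; _∧_; _xor_)
open import Data.List.Base using (List; length)
import Data.List.Relation.Unary.All as List
import Data.List.Relation.Unary.Any as List
open import Data.Nat.Base using (ℕ; _≤_)
open import Data.Product.Base using (Σ-syntax; ∃-syntax; _×_)
open import Data.Vec.Base using (Vec; foldr′; map; replicate; zipWith)
import Data.Vec.Relation.Unary.All as Vec
open import Level using (0ℓ)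
open import Relation.Binary.PropositionalEquality.Core using (_≡_)
open import Relation.Unary using (Pred; _∈_; _⊆_)

-- The two-element field, with the operations of
-- Data.Bool.Properties.xor-∧-commutativeRing (false = 0, true = 1).
𝔽₂ : Set
𝔽₂ = Bool

𝔽₂^_ : ℕ → Set
𝔽₂^ n = Vec 𝔽₂ n

infixl 6 _⊕_
infixl 7 _·_

𝟎 : ∀ {n} → 𝔽₂^ n
𝟎 {n} = replicate n false

_⊕_ : ∀ {n} → 𝔽₂^ n → 𝔽₂^ n → 𝔽₂^ n
_⊕_ = zipWith _xor_

_·_ : ∀ {n} → 𝔽₂ → 𝔽₂^ n → 𝔽₂^ n
a · v = map (a ∧_) v

record Subspace (n : ℕ) : Set₁ where
  field
    Carrier  : Pred (𝔽₂^ n) 0ℓ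
    𝟎-closed : 𝟎 ∈ Carrier
    ⊕-closed : ∀ {u v} → u ∈ Carrier → v ∈ Carrier → u ⊕ v ∈ Carrier
    ·-closed : ∀ a {v} → v ∈ Carrier → a · v ∈ Carrier

open Subspace public using (Carrier)

linearCombination : ∀ {n d} → Vec 𝔽₂ d → Vec (𝔽₂^ n) d → 𝔽₂^ n
linearCombination as vs = foldr′ _⊕_ 𝟎 (zipWith _·_ as vs)

LinearlyIndependent : ∀ {n d} → Vec (𝔽₂^ n) d → Set
LinearlyIndependent {d = d} vs =
  ∀ (as : Vec 𝔽₂ d) → linearCombination as vs ≡ 𝟎 → as ≡ 𝟎

record IsBasis {n d} (U : Subspace n) (vs : Vec (𝔽₂^ n) d) : Set where
  field
    members     : Vec.All (_∈ Carrier U) vs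
    independent : LinearlyIndependent vs
    spanning    : ∀ {u} → u ∈ Carrier U →
                  ∃[ as ] linearCombination as vs ≡ u

HasDimension : ∀ {n} → ℕ → Subspace n → Set
HasDimension {n} d U = Σ[ vs ∈ Vec (𝔽₂^ n) d ] IsBasis U vs

-- A collection is a list, its size the length.  Repetitions are allowed:
-- removing them keeps the covering property and only lowers the size, so
-- the minimum size is the same as for sets of subspaces.
record IsCoveringDesign₂ (n k r : ℕ) (𝒞 : List (Subspace n)) : Set₁ where
  field
    dimension : List.All (HasDimension k) 𝒞
    covering  : ∀ (W : Subspace n) → HasDimension r W →
                List.Any (λ U → Carrier W ⊆ Carrier U) 𝒞

-- m is the minimum size 𝒞₂(n,k,r).  This is a relation because no design
-- exists for some parameters (e.g. r ≤ n < k).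
record IsCoveringNumber₂ (n k r m : ℕ) : Set₁ where
  field
    attained : ∃[ 𝒞 ] IsCoveringDesign₂ n k r 𝒞 × length 𝒞 ≡ m
    minimal  : ∀ 𝒞 → IsCoveringDesign₂ n k r 𝒞 → m ≤ length 𝒞

{-# OPTIONS --safe #-}
-- Write 𝔽₂^(2k) as pairs x ++ s with x, s ∈ 𝔽₂^k and let S be the subspace
-- x = 0.  Identify 𝔽₂^k with the field of order 2^k.  The 2^(2k) graphs of the
-- maps x ↦ a x + b x² cover every 2-space that meets S trivially, because
-- such a map can be prescribed at two independent points.  The other 2-spaces
-- lie in S or in S + ⟨Q⟩ for some Q ∉ S.  In S + ⟨Q⟩ take the hyperplanes other
-- than S through a subspace of codimension 2 in S: these are six, and together
-- with S they cover all 2-spaces of S + ⟨Q⟩.  Letting the codimension 2 subspace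
-- vary with Q inside a pencil, the hyperplanes also cover the 2-spaces of S, so
-- that S itself is not needed.
--
-- The field of order 2^k is a residue field of A = 𝔽₂[x]/(x^N − 1) with
-- N = 2^k − 1.  All a ∈ A satisfy a^(2^k) = a, and the product of all
-- x^(2^d) − x with 0 < d < k has degree N − 1, so it is nonzero in A.  In a
-- residue field where it does not vanish, x has k conjugates, so 1, …, x^(k−1)
-- are independent over 𝔽₂; they span because y^(2^k) − y has at most 2^k roots.
--
-- The minimum exists constructively since a design is determined by bases of
-- its members, which leaves a finite search.
module Submission where

open import Algebra.Bundles using (CommutativeSemiring; RawRing)
import Algebra.Properties.CommutativeSemiring.Exp as Exp
import Algebra.Solver.Ring as RingSolver
open import Algebra.Solver.Ring.AlmostCommutativeRing using (fromCommutativeSemiring; _-Raw-AlmostCommutative⟶_)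
open import Algebra.Structures using (IsCommutativeMonoid)
open import Algebra.Structures.Biased using (isCommutativeSemiringˡ)
open import Data.Bool.Base using (false; true; _∧_; _xor_)
import Data.Bool.Properties as Bool
open import Data.Empty using (⊥; ⊥-elim)
open import Data.List.Base as List using (List; []; _∷_; length; cartesianProductWith)
open import Data.List.Membership.Propositional using (_∈_; lose)
open import Data.List.Membership.Propositional.Properties using (∈-cartesianProductWith⁺; ∈-map⁺; ∈-++⁺ˡ; ∈-++⁺ʳ)
import Data.List.Properties as List
open import Data.List.Relation.Unary.All as All using (All; []; _∷_)
import Data.List.Relation.Unary.All.Properties as All
open import Data.List.Relation.Unary.AllPairs as AllPairs using (AllPairs; []; _∷_)
import Data.List.Relation.Unary.AllPairs.Properties as AllPairs
open import Data.List.Relation.Unary.Any as Any using (Any; here; there)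
import Data.List.Relation.Unary.Any.Properties as Any
open import Data.List.Relation.Unary.Unique.Propositional using (Unique)
import Data.List.Relation.Unary.Unique.Propositional.Properties as Unique
open import Data.Maybe.Base as Maybe using ()
open import Data.Nat.Base using (ℕ; zero; suc; _+_; _*_; _∸_; _^_; _≤_; _<_; z≤n; s≤s)
import Data.Nat.Properties as ℕ
open import Data.Product.Base using (∃-syntax; _×_; _,_; proj₁; proj₂)
open import Data.Sum.Base using (_⊎_; inj₁; inj₂; [_,_]′)
open import Data.Vec.Base as Vec using (Vec; []; _∷_; _++_)
import Data.Vec.Properties as Vec
import Data.Vec.Relation.Unary.All as VecAll
import Data.Vec.Relation.Unary.All.Properties as VecAll
open import Function.Base using (_∘_; id)
open import Level using (0ℓ)
open import Relation.Binary.Definitions using (Decidable)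
open import Relation.Binary.PropositionalEquality using (_≡_; _≢_; refl; sym; trans; cong; cong₂; subst; subst₂; module ≡-Reasoning) renaming (setoid to ≡-setoid; isEquivalence to ≡-isEquivalence)
import Relation.Binary.Reasoning.Setoid as ≈-Reasoning
open import Relation.Binary.Structures using (IsEquivalence)
open import Relation.Nullary using (¬_; Dec; yes; no)
open import Relation.Nullary.Decidable using (map′; from-yes; _×-dec_; _→-dec_; ¬?)
open import Relation.Nullary.Decidable.Core using (dec⇒maybe)
import Relation.Unary as Unary
open import Defs

-- Enumeration of vectors over a finite set.

length-cartesianProductWith : ∀ {a b c} {A : Set a} {B : Set b} {C : Set c} (f : A → B → C) xs ys →
  length (cartesianProductWith f xs ys) ≡ length xs * length ys
length-cartesianProductWith f []       ys = refl
length-cartesianProductWith f (x ∷ xs) ys = begin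
  length (List.map (f x) ys List.++ rest)        ≡⟨ List.length-++ (List.map (f x) ys) ⟩
  length (List.map (f x) ys) + length rest       ≡⟨ cong₂ _+_ (List.length-map (f x) ys) (length-cartesianProductWith f xs ys) ⟩
  length ys + length xs * length ys              ∎
  where
  open ≡-Reasoning
  rest = cartesianProductWith f xs ys

vectors : ∀ {A : Set} → List A → ∀ n → List (Vec A n)
vectors xs zero    = [] ∷ []
vectors xs (suc n) = cartesianProductWith _∷_ xs (vectors xs n)

vectors-complete : ∀ {A : Set} {xs : List A} → (∀ x → x ∈ xs) →
  ∀ {n} (v : Vec A n) → v ∈ vectors xs n
vectors-complete all []      = here refl
vectors-complete all (x ∷ v) = ∈-cartesianProductWith⁺ _∷_ (all x) (vectors-complete all v)

length-vectors : ∀ {A : Set} (xs : List A) n → length (vectors xs n) ≡ length xs ^ n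
length-vectors xs zero    = refl
length-vectors xs (suc n) = trans (length-cartesianProductWith _∷_ xs (vectors xs n))
                                  (cong (length xs *_) (length-vectors xs n))

vectors-unique : ∀ {A : Set} {xs : List A} → Unique xs → ∀ n → Unique (vectors xs n)
vectors-unique u zero    = [] ∷ []
vectors-unique u (suc n) = Unique.cartesianProductWith⁺ _∷_ Vec.∷-injective u (vectors-unique u n)

bits : List 𝔽₂
bits = false ∷ true ∷ []

bits-complete : ∀ b → b ∈ bits
bits-complete false = here refl
bits-complete true  = there (here refl)

points : ∀ n → List (𝔽₂^ n)
points = vectors bits

points-complete : ∀ {n} (v : 𝔽₂^ n) → v ∈ points n
points-complete = vectors-complete bits-complete

points-unique : ∀ n → Unique (points n)
points-unique = vectors-unique (((λ ()) ∷ []) ∷ [] ∷ [])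

_≟ᵥ_ : ∀ {n} → Decidable {A = 𝔽₂^ n} _≡_
_≟ᵥ_ = Vec.≡-dec Bool._≟_

-- Addition in 𝔽₂^n.

⊕-assoc : ∀ {n} (u v w : 𝔽₂^ n) → (u ⊕ v) ⊕ w ≡ u ⊕ (v ⊕ w)
⊕-assoc = Vec.zipWith-assoc Bool.xor-assoc

⊕-comm : ∀ {n} (u v : 𝔽₂^ n) → u ⊕ v ≡ v ⊕ u
⊕-comm = Vec.zipWith-comm Bool.xor-comm

⊕-identityˡ : ∀ {n} (v : 𝔽₂^ n) → 𝟎 ⊕ v ≡ v
⊕-identityˡ = Vec.zipWith-identityˡ Bool.xor-identityˡ

⊕-identityʳ : ∀ {n} (v : 𝔽₂^ n) → v ⊕ 𝟎 ≡ v
⊕-identityʳ = Vec.zipWith-identityʳ Bool.xor-identityʳ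

⊕-self : ∀ {n} (v : 𝔽₂^ n) → v ⊕ v ≡ 𝟎
⊕-self []      = refl
⊕-self (b ∷ v) = cong₂ _∷_ (Bool.xor-same b) (⊕-self v)

⊕-cancelˡ : ∀ {n} (u v : 𝔽₂^ n) → u ⊕ (u ⊕ v) ≡ v
⊕-cancelˡ u v = trans (sym (⊕-assoc u u v)) (trans (cong (_⊕ v) (⊕-self u)) (⊕-identityˡ v))

⊕-zero⇒≡ : ∀ {n} {u v : 𝔽₂^ n} → u ⊕ v ≡ 𝟎 → u ≡ v
⊕-zero⇒≡ {u = u} {v} eq = sym (trans (sym (⊕-cancelˡ u v)) (trans (cong (u ⊕_) eq) (⊕-identityʳ u)))

-- Frobenius powers and polynomials in characteristic two.

CharacteristicTwo : CommutativeSemiring 0ℓ 0ℓ → Set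
CharacteristicTwo R = 1# +ᴿ 1# ≈ 0#
  where open CommutativeSemiring R renaming (_+_ to _+ᴿ_)

module Frobenius (R : CommutativeSemiring 0ℓ 0ℓ) (1+1≈0 : CharacteristicTwo R) where

  open CommutativeSemiring R hiding (_+_; _*_; refl; sym; trans; zero) renaming (Carrier to K)
  open CommutativeSemiring R public using () renaming
    (_+_ to infixl 6 _⊞_; _*_ to infixl 7 _⊠_; refl to ≈-refl; sym to ≈-sym; trans to ≈-trans)
  open Exp R public using () renaming (_^_ to infixr 8 _^ᴿ_; ^-homo-* to ^ᴿ-+)
  open ≈-Reasoning setoid

  ⟦_⟧ : 𝔽₂ → K
  ⟦ false ⟧ = 0#
  ⟦ true  ⟧ = 1#

  ⟦⟧-xor : ∀ a b → ⟦ a xor b ⟧ ≈ ⟦ a ⟧ ⊞ ⟦ b ⟧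
  ⟦⟧-xor false b     = ≈-sym (+-identityˡ ⟦ b ⟧)
  ⟦⟧-xor true  false = ≈-sym (+-identityʳ 1#)
  ⟦⟧-xor true  true  = ≈-sym 1+1≈0

  ⟦⟧-∧ : ∀ a b → ⟦ a ∧ b ⟧ ≈ ⟦ a ⟧ ⊠ ⟦ b ⟧
  ⟦⟧-∧ false b = ≈-sym (zeroˡ ⟦ b ⟧)
  ⟦⟧-∧ true  b = ≈-sym (*-identityˡ ⟦ b ⟧)

  private
    𝔽₂-rawRing : RawRing 0ℓ 0ℓ
    𝔽₂-rawRing = record { _≈_ = _≡_ ; _+_ = _xor_ ; _*_ = _∧_ ; -_ = id ; 0# = false ; 1# = true }

    𝔽₂⟶R : 𝔽₂-rawRing -Raw-AlmostCommutative⟶ fromCommutativeSemiring R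
    𝔽₂⟶R = record
      { ⟦_⟧    = ⟦_⟧
      ; +-homo = ⟦⟧-xor
      ; *-homo = ⟦⟧-∧
      ; -‿homo = λ _ → ≈-refl
      ; 0-homo = ≈-refl
      ; 1-homo = ≈-refl
      }

  -- With coefficients in 𝔽₂ the solver knows that x + x = 0.
  open RingSolver 𝔽₂-rawRing (fromCommutativeSemiring R) 𝔽₂⟶R
    (λ a b → Maybe.map (reflexive ∘ cong ⟦_⟧) (dec⇒maybe (a Bool.≟ b)))
    public using (solve; con; _:=_; _:+_; _:*_)

  ⊞-self : ∀ x → x ⊞ x ≈ 0#
  ⊞-self = solve 1 (λ x → x :+ x := con false) ≈-refl

  ⊞-zero⇒≈ : ∀ {x y} → x ⊞ y ≈ 0# → x ≈ y
  ⊞-zero⇒≈ {x} {y} x+y≈0 = begin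
    x            ≈⟨ solve 2 (λ x y → x := (x :+ y) :+ y) ≈-refl x y ⟩
    (x ⊞ y) ⊞ y  ≈⟨ +-congʳ x+y≈0 ⟩
    0# ⊞ y       ≈⟨ +-identityˡ y ⟩
    y            ∎

  ≈⇒⊞-zero : ∀ {x y} → x ≈ y → x ⊞ y ≈ 0#
  ≈⇒⊞-zero {x} {y} x≈y = ≈-trans (+-congʳ x≈y) (⊞-self y)

  -- The power x^(2^i), as repeated squaring, so that additivity reduces to that of a single
  -- squaring.
  frob : ℕ → K → K
  frob zero    x = x
  frob (suc i) x = frob i x ⊠ frob i x

  frob-cong : ∀ i {x y} → x ≈ y → frob i x ≈ frob i y
  frob-cong zero    x≈y = x≈y
  frob-cong (suc i) x≈y = *-cong (frob-cong i x≈y) (frob-cong i x≈y)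

  frob-⊞ : ∀ i x y → frob i (x ⊞ y) ≈ frob i x ⊞ frob i y
  frob-⊞ zero    x y = ≈-refl
  frob-⊞ (suc i) x y = ≈-trans (*-cong (frob-⊞ i x y) (frob-⊞ i x y))
    (solve 2 (λ x y → (x :+ y) :* (x :+ y) := x :* x :+ y :* y) ≈-refl (frob i x) (frob i y))

  frob-⊠ : ∀ i x y → frob i (x ⊠ y) ≈ frob i x ⊠ frob i y
  frob-⊠ zero    x y = ≈-refl
  frob-⊠ (suc i) x y = ≈-trans (*-cong (frob-⊠ i x y) (frob-⊠ i x y))
    (solve 2 (λ x y → (x :* y) :* (x :* y) := (x :* x) :* (y :* y)) ≈-refl (frob i x) (frob i y))

  frob-⟦⟧ : ∀ i b → frob i ⟦ b ⟧ ≈ ⟦ b ⟧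
  frob-⟦⟧ zero    b = ≈-refl
  frob-⟦⟧ (suc i) b = ≈-trans (*-cong (frob-⟦⟧ i b) (frob-⟦⟧ i b))
    (≈-trans (≈-sym (⟦⟧-∧ b b)) (reflexive (cong ⟦_⟧ (Bool.∧-idem b))))

  frob-+ : ∀ i j x → frob (i + j) x ≈ frob i (frob j x)
  frob-+ zero    j x = ≈-refl
  frob-+ (suc i) j x = *-cong (frob-+ i j x) (frob-+ i j x)

  frob-^ : ∀ i x → frob i x ≈ x ^ᴿ (2 ^ i)
  frob-^ zero    x = ≈-sym (*-identityʳ x)
  frob-^ (suc i) x = begin
    frob i x ⊠ frob i x            ≈⟨ *-cong (frob-^ i x) (frob-^ i x) ⟩
    x ^ᴿ (2 ^ i) ⊠ x ^ᴿ (2 ^ i)    ≈⟨ ^ᴿ-+ x (2 ^ i) (2 ^ i) ⟨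
    x ^ᴿ (2 ^ i + 2 ^ i)           ≡⟨ cong (λ n → x ^ᴿ (2 ^ i + n)) (ℕ.+-identityʳ (2 ^ i)) ⟨
    x ^ᴿ (2 ^ suc i)               ∎

  eval : List K → K → K
  eval []       x = 0#
  eval (c ∷ cs) x = c ⊞ x ⊠ eval cs x

  monomial : ℕ → List K
  monomial n = List.replicate n 0# List.++ 1# ∷ []

  length-monomial : ∀ n → length (monomial n) ≡ suc n
  length-monomial n = trans (List.length-++-comm (List.replicate n 0#) (1# ∷ []))
                            (cong suc (List.length-replicate n))

  eval-monomial : ∀ n x → eval (monomial n) x ≈ x ^ᴿ n
  eval-monomial zero    x = solve 1 (λ x → con true :+ x :* con false := con true) ≈-refl x
  eval-monomial (suc n) x = ≈-trans (+-identityˡ _) (*-congˡ (eval-monomial n x))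

-- The degree of the product of all x ^ 2^i − x with 1 ≤ i ≤ d.
geometric : ℕ → ℕ
geometric zero    = 0
geometric (suc d) = geometric d + 2 ^ suc d

-- This is 2 + 4 + ... + 2^d = 2^(d+1) - 2. The two successors let factors x be split off from
-- x^(2^(d+1)), and they make `suc (geometric κ)` the number N = 2^(κ+1) - 1.
2+geometric : ∀ d → suc (suc (geometric d)) ≡ 2 ^ suc d
2+geometric zero    = refl
2+geometric (suc d) = trans (cong (_+ 2 ^ suc d) (2+geometric d))
                            (cong (2 ^ suc d +_) (sym (ℕ.+-identityʳ (2 ^ suc d))))

-- A field with 2^(κ+1) elements: the Frobenius map has order κ + 1 on it,
-- witnessed by ξ.
record IsGaloisField (R : CommutativeSemiring 0ℓ 0ℓ) (κ : ℕ) : Set where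
  open CommutativeSemiring R using (_≈_; 0#; 1#) renaming (Carrier to K; _*_ to _⊠_)
  field
    1+1≈0     : CharacteristicTwo R
    _≈?_      : Decidable _≈_
    0≉1       : ¬ 0# ≈ 1#
    inverse   : ∀ x → x ≈ 0# ⊎ ∃[ y ] x ⊠ y ≈ 1#
  open Frobenius R 1+1≈0 using (frob)
  field
    frob-fix  : ∀ x → frob (suc κ) x ≈ x
    ξ         : K
    frob-move : ∀ d → d < κ → ¬ frob (suc d) ξ ≈ ξ

-- Roots, coordinates and linearized polynomials in the field of order 2^(κ+1).

module GaloisField (R : CommutativeSemiring 0ℓ 0ℓ) (κ : ℕ) (isGaloisField : IsGaloisField R κ) where
  open CommutativeSemiring R hiding (_+_; _*_; refl; sym; trans; zero) renaming (Carrier to K)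
  open IsGaloisField isGaloisField
  open Frobenius R 1+1≈0
  open ≈-Reasoning setoid

  no-zero-divisors : ∀ {x y} → ¬ x ≈ 0# → x ⊠ y ≈ 0# → y ≈ 0#
  no-zero-divisors {x} {y} x≉0 xy≈0 with inverse x
  ... | inj₁ x≈0       = ⊥-elim (x≉0 x≈0)
  ... | inj₂ (z , xz≈1) = begin
    y            ≈⟨ *-identityˡ y ⟨
    1# ⊠ y       ≈⟨ *-congʳ xz≈1 ⟨
    (x ⊠ z) ⊠ y  ≈⟨ solve 3 (λ x y z → (x :* z) :* y := z :* (x :* y)) ≈-refl x y z ⟩
    z ⊠ (x ⊠ y)  ≈⟨ *-congˡ xy≈0 ⟩
    z ⊠ 0#       ≈⟨ zeroʳ z ⟩
    0#           ∎

  -- The quotient of the polynomial c ∷ cs by x − r, for any c.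
  quotient : List K → K → List K
  quotient []       r = []
  quotient (c ∷ cs) r = eval (c ∷ cs) r ∷ quotient cs r

  length-quotient : ∀ cs r → length (quotient cs r) ≡ length cs
  length-quotient []       r = refl
  length-quotient (c ∷ cs) r = cong suc (length-quotient cs r)

  -- Division with remainder, with + in place of -. For f = c + x g the difference f(x) - f(r) is x
  -- (g(x) - g(r)) + (x - r) g(r), so g(r) is the constant term of the quotient.
  eval-quotient : ∀ c cs r x → eval (c ∷ cs) x ⊞ eval (c ∷ cs) r ≈ (x ⊞ r) ⊠ eval (quotient cs r) x
  eval-quotient c []        r x = solve 3 (λ c r x → c :+ x :* con false :+ (c :+ r :* con false) := (x :+ r) :* con false) ≈-refl c r x
  eval-quotient c (d ∷ cs) r x = begin
    (c ⊞ x ⊠ g x) ⊞ (c ⊞ r ⊠ g r)             ≈⟨ solve 5 (λ c x r gx gr → (c :+ x :* gx) :+ (c :+ r :* gr) := x :* (gx :+ gr) :+ (x :+ r) :* gr) ≈-refl c x r (g x) (g r) ⟩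
    x ⊠ (g x ⊞ g r) ⊞ (x ⊞ r) ⊠ g r           ≈⟨ +-congʳ (*-congˡ (eval-quotient d cs r x)) ⟩
    x ⊠ ((x ⊞ r) ⊠ q) ⊞ (x ⊞ r) ⊠ g r         ≈⟨ solve 4 (λ x r q gr → x :* ((x :+ r) :* q) :+ (x :+ r) :* gr := (x :+ r) :* (gr :+ x :* q)) ≈-refl x r q (g r) ⟩
    (x ⊞ r) ⊠ (g r ⊞ x ⊠ q)                   ∎
    where
    g = eval (d ∷ cs)
    q = eval (quotient cs r) x

  -- The entries of the quotient are the values at r of the tails of the polynomial. If f = c + x g
  -- has root r and g(r) = 0, then c = 0, and r is again a root of g.
  quotient-zero : ∀ c cs r → eval (c ∷ cs) r ≈ 0# → All (_≈ 0#) (quotient cs r) → All (_≈ 0#) (c ∷ cs)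
  quotient-zero c []        r root []        = ≈-trans (solve 2 (λ c r → c := c :+ r :* con false) ≈-refl c r) root ∷ []
  quotient-zero c (d ∷ cs) r root (z ∷ zs) = c≈0 ∷ quotient-zero d cs r z zs
    where
    c≈0 : c ≈ 0#
    c≈0 = begin
      c                        ≈⟨ solve 2 (λ c r → c := c :+ r :* con false) ≈-refl c r ⟩
      c ⊞ r ⊠ 0#               ≈⟨ +-congˡ (*-congˡ z) ⟨
      c ⊞ r ⊠ eval (d ∷ cs) r  ≈⟨ root ⟩
      0#                       ∎

  -- Dividing by x - r removes one coefficient and one root. The other roots are roots of the
  -- quotient, because there are no zero divisors.
  root-bound : ∀ cs rs → AllPairs _≉_ rs → All (λ r → eval cs r ≈ 0#) rs →
    length cs ≤ length rs → All (_≈ 0#) cs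
  root-bound []       rs       distinct       roots          len       = []
  root-bound (c ∷ cs) (r ∷ rs) (r≉ ∷ distinct) (root ∷ roots) (s≤s len) =
    quotient-zero c cs r root
      (root-bound (quotient cs r) rs distinct (All.zipWith root′ (r≉ , roots))
        (subst (_≤ length rs) (sym (length-quotient cs r)) len))
    where
    root′ : ∀ {x} → r ≉ x × eval (c ∷ cs) x ≈ 0# → eval (quotient cs r) x ≈ 0#
    root′ {x} (r≉x , fx≈0) = no-zero-divisors (λ x+r≈0 → r≉x (≈-sym (⊞-zero⇒≈ x+r≈0))) (begin
      (x ⊞ r) ⊠ eval (quotient cs r) x     ≈⟨ eval-quotient c cs r x ⟨
      eval (c ∷ cs) x ⊞ eval (c ∷ cs) r    ≈⟨ +-cong fx≈0 root ⟩
      0# ⊞ 0#                              ≈⟨ +-identityˡ 0# ⟩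
      0#                                   ∎)

  coefficients : ∀ {n} → 𝔽₂^ n → List K
  coefficients v = List.map ⟦_⟧ (Vec.toList v)

  ⟦⟧-zero : ∀ b → ⟦ b ⟧ ≈ 0# → b ≡ false
  ⟦⟧-zero false _   = refl
  ⟦⟧-zero true  1≈0 = ⊥-elim (0≉1 (≈-sym 1≈0))

  coefficients-zero : ∀ {n} (v : 𝔽₂^ n) → All (_≈ 0#) (coefficients v) → v ≡ 𝟎
  coefficients-zero []      []       = refl
  coefficients-zero (b ∷ v) (z ∷ zs) = cong₂ _∷_ (⟦⟧-zero b z) (coefficients-zero v zs)

  length-coefficients : ∀ {n} (v : 𝔽₂^ n) → length (coefficients v) ≡ n
  length-coefficients v = trans (List.length-map ⟦_⟧ (Vec.toList v)) (Vec.length-toList v)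

  -- The identification of 𝔽₂^(κ+1) with the field, for n = κ + 1: the vector lists coordinates with
  -- respect to 1, ξ, ξ², ....
  element : ∀ {n} → 𝔽₂^ n → K
  element v = eval (coefficients v) ξ

  element-⊕ : ∀ {n} (u v : 𝔽₂^ n) → element (u ⊕ v) ≈ element u ⊞ element v
  element-⊕ []      []      = ≈-sym (+-identityˡ 0#)
  element-⊕ (a ∷ u) (b ∷ v) = ≈-trans (+-cong (⟦⟧-xor a b) (*-congˡ (element-⊕ u v)))
    (solve 5 (λ a b x u v → (a :+ b) :+ x :* (u :+ v) := (a :+ x :* u) :+ (b :+ x :* v)) ≈-refl
      ⟦ a ⟧ ⟦ b ⟧ ξ (element u) (element v))

  -- Frobenius powers are ring homomorphisms fixing the coefficients, which lie in 𝔽₂.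
  eval-frob : ∀ {n} (v : 𝔽₂^ n) i x → eval (coefficients v) (frob i x) ≈ frob i (eval (coefficients v) x)
  eval-frob []      i x = ≈-sym (frob-⟦⟧ i false)
  eval-frob (b ∷ v) i x = begin
    ⟦ b ⟧ ⊞ frob i x ⊠ eval (coefficients v) (frob i x)           ≈⟨ +-cong (≈-sym (frob-⟦⟧ i b)) (*-congˡ (eval-frob v i x)) ⟩
    frob i ⟦ b ⟧ ⊞ frob i x ⊠ frob i (eval (coefficients v) x)    ≈⟨ +-congˡ (frob-⊠ i x _) ⟨
    frob i ⟦ b ⟧ ⊞ frob i (x ⊠ eval (coefficients v) x)           ≈⟨ frob-⊞ i _ _ ⟨
    frob i (⟦ b ⟧ ⊞ x ⊠ eval (coefficients v) x)                  ∎

  frob-zero : ∀ i {x} → frob i x ≈ 0# → x ≈ 0#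
  frob-zero zero    x≈0 = x≈0
  frob-zero (suc i) {x} eq with frob i x ≈? 0#
  ... | yes z = frob-zero i z
  ... | no ¬z = frob-zero i (no-zero-divisors ¬z eq)

  frob-injective : ∀ i {x y} → frob i x ≈ frob i y → x ≈ y
  frob-injective i {x} {y} eq = ⊞-zero⇒≈ (frob-zero i (≈-trans (frob-⊞ i x y) (≈⇒⊞-zero eq)))

  -- Cancelling `frob i`, which is injective, from an equality of conjugates would leave ξ fixed by
  -- `frob (j ∸ i)`, where 1 ≤ j - i ≤ κ.
  conjugates-distinct : ∀ {i j} → i < j → j < suc κ → frob i ξ ≉ frob j ξ
  conjugates-distinct {i} {j} i<j (s≤s j≤κ) eq with ℕ.m≤n⇒∃[o]m+o≡n i<j
  ... | d , refl = frob-move d (ℕ.≤-trans (s≤s (ℕ.m≤n+m d i)) j≤κ)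
    (≈-sym (frob-injective i (≈-trans eq (≈-trans (reflexive (cong (λ n → frob n ξ) (sym (ℕ.+-suc i d)))) (frob-+ i (suc d) ξ)))))

  -- A polynomial over 𝔽₂ with root ξ has all κ + 1 conjugates of ξ as roots.
  element-zero : ∀ (v : 𝔽₂^ suc κ) → element v ≈ 0# → v ≡ 𝟎
  element-zero v eq = coefficients-zero v (root-bound (coefficients v) conjugates
      (AllPairs.applyUpTo⁺₁ (λ i → frob i ξ) (suc κ) conjugates-distinct)
      (All.applyUpTo⁺₂ (λ i → frob i ξ) (suc κ) (λ i → ≈-trans (eval-frob v i ξ) (≈-trans (frob-cong i eq) (frob-⟦⟧ i false))))
      (ℕ.≤-reflexive (trans (length-coefficients v) (sym (List.length-applyUpTo (λ i → frob i ξ) (suc κ))))))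
    where conjugates = List.applyUpTo (λ i → frob i ξ) (suc κ)

  element-injective : ∀ {u v : 𝔽₂^ suc κ} → element u ≈ element v → u ≡ v
  element-injective {u} {v} eq = ⊕-zero⇒≡ (element-zero (u ⊕ v) (≈-trans (element-⊕ u v) (≈⇒⊞-zero eq)))

  -- An element outside the image would be one root too many for the
  -- polynomial x + x ^ 2^(κ+1).
  element-surjective : ∀ x → ∃[ v ] element {suc κ} v ≈ x
  element-surjective x with Any.any? (λ v → element v ≈? x) (points (suc κ))
  ... | yes v∈ = Any.satisfied v∈
  ... | no  v∉ = ⊥-elim (0≉1 (≈-sym (All.head (All.++⁻ʳ (List.replicate m 0#) (All.tail (All.tail all-zero))))))
    where
    m = geometric κ
    -- Since m + 2 = 2^(κ+1), this is x + x^(2^(κ+1)). It has 2^(κ+1) + 1 coefficients, as many as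
    -- there are roots in `rs`, so even its leading coefficient 1 would vanish.
    cs = 0# ∷ 1# ∷ monomial m
    rs = x ∷ List.map element (points (suc κ))
    distinct : AllPairs _≉_ rs
    distinct = All.map⁺ (All.map (λ ¬eq eq → ¬eq (≈-sym eq)) (All.¬Any⇒All¬ _ v∉))
             ∷ AllPairs.map⁺ (AllPairs.map (λ u≢v eq → u≢v (element-injective eq)) (points-unique (suc κ)))
    root : ∀ z → eval cs z ≈ 0#
    root z = begin
      0# ⊞ z ⊠ (1# ⊞ z ⊠ eval (monomial m) z)  ≈⟨ +-congˡ (*-congˡ (+-congˡ (*-congˡ (eval-monomial m z)))) ⟩
      0# ⊞ z ⊠ (1# ⊞ z ⊠ z ^ᴿ m)      ≈⟨ solve 2 (λ z w → con false :+ z :* (con true :+ z :* w) := z :+ z :* (z :* w)) ≈-refl z (z ^ᴿ m) ⟩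
      z ⊞ z ^ᴿ suc (suc m)            ≡⟨ cong (λ n → z ⊞ z ^ᴿ n) (2+geometric κ) ⟩
      z ⊞ z ^ᴿ (2 ^ suc κ)            ≈⟨ +-congˡ (frob-^ (suc κ) z) ⟨
      z ⊞ frob (suc κ) z              ≈⟨ +-congˡ (frob-fix z) ⟩
      z ⊞ z                           ≈⟨ ⊞-self z ⟩
      0#                              ∎
    len : length cs ≡ length rs
    len = cong suc (trans (cong suc (length-monomial m))
                   (trans (2+geometric κ)
                   (trans (sym (length-vectors bits (suc κ)))
                          (sym (List.length-map element (points (suc κ)))))))
    all-zero : All (_≈ 0#) cs
    all-zero = root-bound cs rs distinct (All.universal root rs) (ℕ.≤-reflexive len)

  linearized : 𝔽₂^ suc κ → 𝔽₂^ suc κ → K → K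
  linearized a b x = element a ⊠ x ⊞ element b ⊠ (x ⊠ x)

  linearized-cong : ∀ a b {x y} → x ≈ y → linearized a b x ≈ linearized a b y
  linearized-cong a b x≈y = +-cong (*-congˡ x≈y) (*-congˡ (*-cong x≈y x≈y))

  linearized-⊞ : ∀ a b x y → linearized a b (x ⊞ y) ≈ linearized a b x ⊞ linearized a b y
  linearized-⊞ a b = solve 4 (λ a b x y → a :* (x :+ y) :+ b :* ((x :+ y) :* (x :+ y)) :=
    (a :* x :+ b :* (x :* x)) :+ (a :* y :+ b :* (y :* y))) ≈-refl (element a) (element b)

  linearizedᵥ : 𝔽₂^ suc κ → 𝔽₂^ suc κ → 𝔽₂^ suc κ → 𝔽₂^ suc κ
  linearizedᵥ a b x = proj₁ (element-surjective (linearized a b (element x)))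

  element-linearizedᵥ : ∀ a b x → element (linearizedᵥ a b x) ≈ linearized a b (element x)
  element-linearizedᵥ a b x = proj₂ (element-surjective (linearized a b (element x)))

  linearizedᵥ-⊕ : ∀ a b x y → linearizedᵥ a b (x ⊕ y) ≡ linearizedᵥ a b x ⊕ linearizedᵥ a b y
  linearizedᵥ-⊕ a b x y = element-injective (begin
    element (linearizedᵥ a b (x ⊕ y))                              ≈⟨ element-linearizedᵥ a b (x ⊕ y) ⟩
    linearized a b (element (x ⊕ y))                               ≈⟨ linearized-cong a b (element-⊕ x y) ⟩
    linearized a b (element x ⊞ element y)                         ≈⟨ linearized-⊞ a b (element x) (element y) ⟩
    linearized a b (element x) ⊞ linearized a b (element y)        ≈⟨ +-cong (element-linearizedᵥ a b x) (element-linearizedᵥ a b y) ⟨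
    element (linearizedᵥ a b x) ⊞ element (linearizedᵥ a b y)      ≈⟨ element-⊕ (linearizedᵥ a b x) (linearizedᵥ a b y) ⟨
    element (linearizedᵥ a b x ⊕ linearizedᵥ a b y)                ∎)

  -- Cramer's rule; the determinant is pq(p + q).
  interpolate : ∀ {p q} → p ≉ 0# → q ≉ 0# → p ≉ q → ∀ u v →
    ∃[ a ] ∃[ b ] linearized a b p ≈ u × linearized a b q ≈ v
  interpolate {p} {q} p≉0 q≉0 p≉q u v with inverse (p ⊠ (q ⊠ (p ⊞ q)))
  ... | inj₁ δ≈0 = ⊥-elim (p≉q (⊞-zero⇒≈ (no-zero-divisors q≉0 (no-zero-divisors p≉0 δ≈0))))
  ... | inj₂ (i , δi≈1) = proj₁ a , proj₁ b ,
    ≈-trans (+-cong (*-congʳ (proj₂ a)) (*-congʳ (proj₂ b)))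
      (≈-trans (solve 5 (λ p q u v i →
          (i :* (u :* (q :* q) :+ v :* (p :* p))) :* p :+ (i :* (u :* q :+ v :* p)) :* (p :* p)
            := (p :* (q :* (p :+ q)) :* i) :* u) ≈-refl p q u v i)
        (≈-trans (*-congʳ δi≈1) (*-identityˡ u))) ,
    ≈-trans (+-cong (*-congʳ (proj₂ a)) (*-congʳ (proj₂ b)))
      (≈-trans (solve 5 (λ p q u v i →
          (i :* (u :* (q :* q) :+ v :* (p :* p))) :* q :+ (i :* (u :* q :+ v :* p)) :* (q :* q)
            := (p :* (q :* (p :+ q)) :* i) :* v) ≈-refl p q u v i)
        (≈-trans (*-congʳ δi≈1) (*-identityˡ v)))
    where
    a = element-surjective (i ⊠ (u ⊠ (q ⊠ q) ⊞ v ⊠ (p ⊠ p)))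
    b = element-surjective (i ⊠ (u ⊠ q ⊞ v ⊠ p))

  -- Nonzero and distinct means independent over 𝔽₂, which is what makes the determinant in
  -- `interpolate` nonzero.
  linearizedᵥ-interpolate : ∀ {x y} → x ≢ 𝟎 → y ≢ 𝟎 → x ≢ y → ∀ u v →
    ∃[ a ] ∃[ b ] linearizedᵥ a b x ≡ u × linearizedᵥ a b y ≡ v
  linearizedᵥ-interpolate {x} {y} x≢0 y≢0 x≢y u v =
    let a , b , eqᵤ , eqᵥ = interpolate (x≢0 ∘ element-zero x) (y≢0 ∘ element-zero y)
                              (x≢y ∘ element-injective) (element u) (element v)
    in a , b , element-injective (≈-trans (element-linearizedᵥ a b x) eqᵤ) ,
               element-injective (≈-trans (element-linearizedᵥ a b y) eqᵥ)

-- Scalars in 𝔽₂^n and the cyclic algebra 𝔽₂[x]/(x^(n+1) - 1).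

·-zeroˡ : ∀ {n} (v : 𝔽₂^ n) → false · v ≡ 𝟎
·-zeroˡ []      = refl
·-zeroˡ (b ∷ v) = cong (false ∷_) (·-zeroˡ v)

·-identityˡ : ∀ {n} (v : 𝔽₂^ n) → true · v ≡ v
·-identityˡ = Vec.map-id

·-zeroʳ : ∀ {n} a → a · 𝟎 {n} ≡ 𝟎
·-zeroʳ {zero}  a = refl
·-zeroʳ {suc n} a = cong₂ _∷_ (Bool.∧-zeroʳ a) (·-zeroʳ a)

·-distribˡ-⊕ : ∀ {n} a (u v : 𝔽₂^ n) → a · (u ⊕ v) ≡ a · u ⊕ a · v
·-distribˡ-⊕ a []      []      = refl
·-distribˡ-⊕ a (b ∷ u) (c ∷ v) = cong₂ _∷_ (Bool.∧-distribˡ-xor a b c) (·-distribˡ-⊕ a u v)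

·-distribʳ-xor : ∀ {n} (v : 𝔽₂^ n) a b → (a xor b) · v ≡ a · v ⊕ b · v
·-distribʳ-xor []      a b = refl
·-distribʳ-xor (c ∷ v) a b = cong₂ _∷_ (Bool.∧-distribʳ-xor c a b) (·-distribʳ-xor v a b)

⊕-isCommutativeMonoid : ∀ {n} → IsCommutativeMonoid _≡_ (_⊕_ {n}) 𝟎
⊕-isCommutativeMonoid = record
  { isMonoid = record
    { isSemigroup = record
      { isMagma = record { isEquivalence = ≡-isEquivalence ; ∙-cong = cong₂ _⊕_ }
      ; assoc   = ⊕-assoc
      }
    ; identity = ⊕-identityˡ , ⊕-identityʳ
    }
  ; comm = ⊕-comm
  }

⊕-interchange : ∀ {n} (a b c d : 𝔽₂^ n) → (a ⊕ b) ⊕ (c ⊕ d) ≡ (a ⊕ c) ⊕ (b ⊕ d)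
⊕-interchange a b c d = begin
  (a ⊕ b) ⊕ (c ⊕ d)  ≡⟨ ⊕-assoc a b (c ⊕ d) ⟩
  a ⊕ (b ⊕ (c ⊕ d))  ≡⟨ cong (a ⊕_) (⊕-assoc b c d) ⟨
  a ⊕ ((b ⊕ c) ⊕ d)  ≡⟨ cong (λ w → a ⊕ (w ⊕ d)) (⊕-comm b c) ⟩
  a ⊕ ((c ⊕ b) ⊕ d)  ≡⟨ cong (a ⊕_) (⊕-assoc c b d) ⟩
  a ⊕ (c ⊕ (b ⊕ d))  ≡⟨ ⊕-assoc a c (b ⊕ d) ⟨
  (a ⊕ c) ⊕ (b ⊕ d)  ∎
  where open ≡-Reasoning

-- push a v and final a v are the initial part and the last entry of a ∷ v.
push : ∀ {n} → 𝔽₂ → 𝔽₂^ n → 𝔽₂^ n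
push a []      = []
push a (b ∷ v) = a ∷ push b v

final : ∀ {n} → 𝔽₂ → 𝔽₂^ n → 𝔽₂
final a []      = a
final a (b ∷ v) = final b v

-- Multiplication by x modulo x^(n+1) - 1, on coefficient vectors with the constant term first.
rotate : ∀ {n} → 𝔽₂^ suc n → 𝔽₂^ suc n
rotate (a ∷ v) = final a v ∷ push a v

push-⊕ : ∀ {n} a b (u v : 𝔽₂^ n) → push (a xor b) (u ⊕ v) ≡ push a u ⊕ push b v
push-⊕ a b []      []      = refl
push-⊕ a b (c ∷ u) (d ∷ v) = cong ((a xor b) ∷_) (push-⊕ c d u v)

final-⊕ : ∀ {n} a b (u v : 𝔽₂^ n) → final (a xor b) (u ⊕ v) ≡ final a u xor final b v
final-⊕ a b []      []      = refl
final-⊕ a b (c ∷ u) (d ∷ v) = final-⊕ c d u v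

rotate-⊕ : ∀ {n} (u v : 𝔽₂^ suc n) → rotate (u ⊕ v) ≡ rotate u ⊕ rotate v
rotate-⊕ (a ∷ u) (b ∷ v) = cong₂ _∷_ (final-⊕ a b u v) (push-⊕ a b u v)

final-𝟎 : ∀ n → final false (𝟎 {n}) ≡ false
final-𝟎 zero    = refl
final-𝟎 (suc n) = final-𝟎 n

push-𝟎 : ∀ n → push false (𝟎 {n}) ≡ 𝟎
push-𝟎 zero    = refl
push-𝟎 (suc n) = cong (false ∷_) (push-𝟎 n)

rotate-𝟎 : ∀ {n} → rotate (𝟎 {suc n}) ≡ 𝟎
rotate-𝟎 {n} = cong₂ _∷_ (final-𝟎 n) (push-𝟎 n)

rotate-· : ∀ {n} a (v : 𝔽₂^ suc n) → rotate (a · v) ≡ a · rotate v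
rotate-· false v = trans (cong rotate (·-zeroˡ v)) (trans rotate-𝟎 (sym (·-zeroˡ (rotate v))))
rotate-· true  v = trans (cong rotate (·-identityˡ v)) (sym (·-identityˡ (rotate v)))

-- Truncating when n < m.
pad : ∀ {m n} → 𝔽₂^ m → 𝔽₂^ n
pad {n = zero}  p       = []
pad {n = suc n} []      = 𝟎
pad {n = suc n} (a ∷ p) = a ∷ pad p

pad-id : ∀ {n} (p : 𝔽₂^ n) → pad p ≡ p
pad-id []      = refl
pad-id (a ∷ p) = cong (a ∷_) (pad-id p)

-- For m ≤ n the last entry of pad p is zero.
rotate-pad : ∀ {m n} (p : 𝔽₂^ m) → m ≤ n → rotate (pad {n = suc n} p) ≡ false ∷ pad p
rotate-pad {n = zero}  []      z≤n       = refl
rotate-pad {n = suc n} []      z≤n       = rotate-𝟎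
rotate-pad {n = suc n} (a ∷ p) (s≤s m≤n) with pad {n = suc n} p | rotate-pad p m≤n
... | c ∷ v | eq = cong₂ _∷_ (Vec.∷-injectiveˡ eq) (cong (a ∷_) (Vec.∷-injectiveʳ eq))

-- Evaluates a polynomial at the rotation.  As 𝟏 is a cyclic vector this is
-- the multiplication of 𝔽₂[x]/(x^(n+1) − 1) in the basis of powers of x.
act : ∀ {m n} → 𝔽₂^ m → 𝔽₂^ suc n → 𝔽₂^ suc n
act []      v = 𝟎
act (a ∷ p) v = a · v ⊕ rotate (act p v)

𝟏 : ∀ {n} → 𝔽₂^ suc n
𝟏 = true ∷ 𝟎

module _ {n : ℕ} where

  act-⊕ʳ : ∀ {m} (p : 𝔽₂^ m) (u v : 𝔽₂^ suc n) → act p (u ⊕ v) ≡ act p u ⊕ act p v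
  act-⊕ʳ []      u v = sym (⊕-identityˡ 𝟎)
  act-⊕ʳ (a ∷ p) u v = begin
    a · (u ⊕ v) ⊕ rotate (act p (u ⊕ v))                          ≡⟨ cong₂ _⊕_ (·-distribˡ-⊕ a u v) (cong rotate (act-⊕ʳ p u v)) ⟩
    (a · u ⊕ a · v) ⊕ rotate (act p u ⊕ act p v)                  ≡⟨ cong ((a · u ⊕ a · v) ⊕_) (rotate-⊕ (act p u) (act p v)) ⟩
    (a · u ⊕ a · v) ⊕ (rotate (act p u) ⊕ rotate (act p v))       ≡⟨ ⊕-interchange (a · u) (a · v) (rotate (act p u)) (rotate (act p v)) ⟩
    (a · u ⊕ rotate (act p u)) ⊕ (a · v ⊕ rotate (act p v))       ∎
    where open ≡-Reasoning

  act-⊕ˡ : ∀ {m} (p q : 𝔽₂^ m) (v : 𝔽₂^ suc n) → act (p ⊕ q) v ≡ act p v ⊕ act q v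
  act-⊕ˡ []      []      v = sym (⊕-identityˡ 𝟎)
  act-⊕ˡ (a ∷ p) (b ∷ q) v = begin
    (a xor b) · v ⊕ rotate (act (p ⊕ q) v)                        ≡⟨ cong₂ _⊕_ (·-distribʳ-xor v a b) (cong rotate (act-⊕ˡ p q v)) ⟩
    (a · v ⊕ b · v) ⊕ rotate (act p v ⊕ act q v)                  ≡⟨ cong ((a · v ⊕ b · v) ⊕_) (rotate-⊕ (act p v) (act q v)) ⟩
    (a · v ⊕ b · v) ⊕ (rotate (act p v) ⊕ rotate (act q v))       ≡⟨ ⊕-interchange (a · v) (b · v) (rotate (act p v)) (rotate (act q v)) ⟩
    (a · v ⊕ rotate (act p v)) ⊕ (b · v ⊕ rotate (act q v))       ∎
    where open ≡-Reasoning

  act-𝟎ˡ : ∀ m (v : 𝔽₂^ suc n) → act (𝟎 {m}) v ≡ 𝟎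
  act-𝟎ˡ zero    v = refl
  act-𝟎ˡ (suc m) v = trans (cong₂ _⊕_ (·-zeroˡ v) (trans (cong rotate (act-𝟎ˡ m v)) rotate-𝟎)) (⊕-identityˡ 𝟎)

  act-𝟎ʳ : ∀ {m} (p : 𝔽₂^ m) → act p (𝟎 {suc n}) ≡ 𝟎
  act-𝟎ʳ []      = refl
  act-𝟎ʳ (a ∷ p) = trans (cong₂ _⊕_ (·-zeroʳ a) (trans (cong rotate (act-𝟎ʳ p)) rotate-𝟎)) (⊕-identityˡ 𝟎)

  act-·ʳ : ∀ {m} (p : 𝔽₂^ m) a (v : 𝔽₂^ suc n) → act p (a · v) ≡ a · act p v
  act-·ʳ p false v = trans (cong (act p) (·-zeroˡ v)) (trans (act-𝟎ʳ p) (sym (·-zeroˡ (act p v))))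
  act-·ʳ p true  v = trans (cong (act p) (·-identityˡ v)) (sym (·-identityˡ (act p v)))

  act-rotate : ∀ {m} (p : 𝔽₂^ m) (v : 𝔽₂^ suc n) → act p (rotate v) ≡ rotate (act p v)
  act-rotate []      v = sym rotate-𝟎
  act-rotate (a ∷ p) v = trans (cong₂ _⊕_ (sym (rotate-· a v)) (cong rotate (act-rotate p v)))
                               (sym (rotate-⊕ (a · v) (rotate (act p v))))

  -- Both are polynomials in the one operator `rotate`.
  act-comm : ∀ {l m} (p : 𝔽₂^ l) (q : 𝔽₂^ m) (v : 𝔽₂^ suc n) → act p (act q v) ≡ act q (act p v)
  act-comm []      q v = sym (act-𝟎ʳ q)
  act-comm (a ∷ p) q v = begin
    a · act q v ⊕ rotate (act p (act q v))   ≡⟨ cong₂ _⊕_ (sym (act-·ʳ q a v)) (cong rotate (act-comm p q v)) ⟩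
    act q (a · v) ⊕ rotate (act q (act p v)) ≡⟨ cong (act q (a · v) ⊕_) (act-rotate q (act p v)) ⟨
    act q (a · v) ⊕ act q (rotate (act p v)) ≡⟨ act-⊕ʳ q (a · v) (rotate (act p v)) ⟨
    act q (a · v ⊕ rotate (act p v))         ∎
    where open ≡-Reasoning

  -- With at most n + 1 coefficients no power of x wraps around, so the polynomial applied to 1
  -- shows its own coefficients.
  act-𝟏-pad : ∀ {m} (p : 𝔽₂^ m) → m ≤ suc n → act p (𝟏 {n}) ≡ pad p
  act-𝟏-pad []      m≤n       = refl
  act-𝟏-pad (a ∷ p) (s≤s m≤n) = begin
    a · 𝟏 ⊕ rotate (act p 𝟏)                        ≡⟨ cong₂ _⊕_ (cong₂ _∷_ (Bool.∧-identityʳ a) (·-zeroʳ a)) (cong rotate (act-𝟏-pad p (ℕ.m≤n⇒m≤1+n m≤n))) ⟩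
    (a ∷ 𝟎) ⊕ rotate (pad p)                        ≡⟨ cong ((a ∷ 𝟎) ⊕_) (rotate-pad p m≤n) ⟩
    (a xor false) ∷ (𝟎 ⊕ pad p)                     ≡⟨ cong₂ _∷_ (Bool.xor-identityʳ a) (⊕-identityˡ (pad p)) ⟩
    a ∷ pad p                                       ∎
    where open ≡-Reasoning

  act-𝟏 : ∀ (p : 𝔽₂^ suc n) → act p 𝟏 ≡ p
  act-𝟏 p = trans (act-𝟏-pad p ℕ.≤-refl) (pad-id p)

  -- The operators commute, and applying them to the cyclic vector 𝟏 recovers p and q.
  ⊛-comm : ∀ (p q : 𝔽₂^ suc n) → act p q ≡ act q p
  ⊛-comm p q = begin
    act p q            ≡⟨ cong (act p) (act-𝟏 q) ⟨
    act p (act q 𝟏)    ≡⟨ act-comm p q 𝟏 ⟩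
    act q (act p 𝟏)    ≡⟨ cong (act q) (act-𝟏 p) ⟩
    act q p            ∎
    where open ≡-Reasoning

  -- Once products commute, associativity is the commutation of the operators `act p` and `act r` at
  -- q.
  ⊛-assoc : ∀ (p q r : 𝔽₂^ suc n) → act (act p q) r ≡ act p (act q r)
  ⊛-assoc p q r = begin
    act (act p q) r    ≡⟨ ⊛-comm (act p q) r ⟩
    act r (act p q)    ≡⟨ act-comm r p q ⟩
    act p (act r q)    ≡⟨ cong (act p) (⊛-comm r q) ⟩
    act p (act q r)    ∎
    where open ≡-Reasoning

  ⊛-identityˡ : ∀ (p : 𝔽₂^ suc n) → act (𝟏 {n}) p ≡ p
  ⊛-identityˡ p = trans (⊛-comm (𝟏 {n}) p) (act-𝟏 p)

cyclicAlgebra : ℕ → CommutativeSemiring 0ℓ 0ℓ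
cyclicAlgebra n = record
  { Carrier = 𝔽₂^ suc n
  ; _≈_     = _≡_
  ; _+_     = _⊕_
  ; _*_     = act
  ; 0#      = 𝟎
  ; 1#      = 𝟏
  ; isCommutativeSemiring = isCommutativeSemiringˡ (record
      { +-isCommutativeMonoid = ⊕-isCommutativeMonoid
      ; *-isCommutativeMonoid = record
          { isMonoid = record
            { isSemigroup = record
              { isMagma = record { isEquivalence = ≡-isEquivalence ; ∙-cong = cong₂ act }
              ; assoc   = ⊛-assoc
              }
            ; identity = ⊛-identityˡ , act-𝟏
            }
          ; comm = ⊛-comm
          }
      ; distribʳ = λ v p q → act-⊕ˡ p q v
      ; zeroˡ    = λ v → act-𝟎ˡ (suc n) v
      })
  }

-- R modulo the annihilator of e.
residueRing : (R : CommutativeSemiring 0ℓ 0ℓ) → CommutativeSemiring.Carrier R → CommutativeSemiring 0ℓ 0ℓ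
residueRing R e = record
  { Carrier = K
  ; _≈_     = λ x y → e ⊠ x ≈ e ⊠ y
  ; _+_     = _⊞_
  ; _*_     = _⊠_
  ; 0#      = 0#
  ; 1#      = 1#
  ; isCommutativeSemiring = isCommutativeSemiringˡ (record
      { +-isCommutativeMonoid = record
          { isMonoid = record
            { isSemigroup = record
              { isMagma = record { isEquivalence = ≈ₑ-isEquivalence ; ∙-cong = ⊞-congₑ }
              ; assoc   = λ x y z → *-congˡ (+-assoc x y z)
              }
            ; identity = (λ x → *-congˡ (+-identityˡ x)) , (λ x → *-congˡ (+-identityʳ x))
            }
          ; comm = λ x y → *-congˡ (+-comm x y)
          }
      ; *-isCommutativeMonoid = record
          { isMonoid = record
            { isSemigroup = record
              { isMagma = record { isEquivalence = ≈ₑ-isEquivalence ; ∙-cong = ⊠-congₑ }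
              ; assoc   = λ x y z → *-congˡ (*-assoc x y z)
              }
            ; identity = (λ x → *-congˡ (*-identityˡ x)) , (λ x → *-congˡ (*-identityʳ x))
            }
          ; comm = λ x y → *-congˡ (*-comm x y)
          }
      ; distribʳ = λ x y z → *-congˡ (distribʳ x y z)
      ; zeroˡ    = λ x → *-congˡ (zeroˡ x)
      })
  }
  where
  open CommutativeSemiring R renaming (Carrier to K; _+_ to infixl 6 _⊞_; _*_ to infixl 7 _⊠_; refl to ≈-refl; sym to ≈-sym; trans to ≈-trans)
  open ≈-Reasoning setoid

  ≈ₑ-isEquivalence : IsEquivalence (λ x y → e ⊠ x ≈ e ⊠ y)
  ≈ₑ-isEquivalence = record { refl = ≈-refl ; sym = ≈-sym ; trans = ≈-trans }

  ⊞-congₑ : ∀ {x y u v} → e ⊠ x ≈ e ⊠ y → e ⊠ u ≈ e ⊠ v → e ⊠ (x ⊞ u) ≈ e ⊠ (y ⊞ v)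
  ⊞-congₑ {x} {y} {u} {v} p q = ≈-trans (distribˡ e x u) (≈-trans (+-cong p q) (≈-sym (distribˡ e y v)))

  ⊠-congₑ : ∀ {x y u v} → e ⊠ x ≈ e ⊠ y → e ⊠ u ≈ e ⊠ v → e ⊠ (x ⊠ u) ≈ e ⊠ (y ⊠ v)
  ⊠-congₑ {x} {y} {u} {v} p q = begin
    e ⊠ (x ⊠ u)  ≈⟨ *-assoc e x u ⟨
    e ⊠ x ⊠ u    ≈⟨ *-congʳ p ⟩
    e ⊠ y ⊠ u    ≈⟨ *-congʳ (*-comm e y) ⟩
    y ⊠ e ⊠ u    ≈⟨ *-assoc y e u ⟩
    y ⊠ (e ⊠ u)  ≈⟨ *-congˡ q ⟩
    y ⊠ (e ⊠ v)  ≈⟨ *-assoc y e v ⟨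
    y ⊠ e ⊠ v    ≈⟨ *-congʳ (*-comm y e) ⟩
    e ⊠ y ⊠ v    ≈⟨ *-assoc e y v ⟩
    e ⊠ (y ⊠ v)  ∎

-- A residue field of a finite ring in which x^(2^(κ+1)) = x.

module ResidueField (R : CommutativeSemiring 0ℓ 0ℓ) (1+1≈0 : CharacteristicTwo R) where

  open CommutativeSemiring R hiding (_+_; _*_; refl; sym; trans; zero) renaming (Carrier to K)
  open Frobenius R 1+1≈0
  open ≈-Reasoning setoid

  -- In a field, this product is nonzero exactly when none of the first d iterates of squaring fixes
  -- ξ.
  gaps : K → ℕ → K
  gaps ξ zero    = 1#
  gaps ξ (suc d) = gaps ξ d ⊠ (frob (suc d) ξ ⊞ ξ)

  gap∣gaps : ∀ ξ {d n} → d < n → ∃[ h ] (frob (suc d) ξ ⊞ ξ) ⊠ h ≈ gaps ξ n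
  gap∣gaps ξ {d} {suc n} (s≤s d≤n) with ℕ.m≤n⇒m<n∨m≡n d≤n
  ... | inj₂ refl = gaps ξ n , *-comm _ _
  ... | inj₁ d<n  = let h , eq = gap∣gaps ξ d<n in
                    h ⊠ (frob (suc n) ξ ⊞ ξ) , ≈-trans (≈-sym (*-assoc _ _ _)) (*-congʳ eq)

  module _ (κ : ℕ) (_≈?_ : Decidable _≈_) (elements : List K) (complete : ∀ x → x ∈ elements)
           (frob-fix : ∀ x → frob (suc κ) x ≈ x) where

    private m = geometric κ

    ^-fix : ∀ x → x ^ᴿ suc (suc m) ≈ x
    ^-fix x = ≈-trans (reflexive (cong (x ^ᴿ_) (2+geometric κ))) (≈-trans (≈-sym (frob-^ (suc κ) x)) (frob-fix x))

    -- With N = m + 1, the power x^N is idempotent: x^(2N) = x^(N+1) x^(N-1) = x x^(N-1).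
    ^-absorb : ∀ x → x ^ᴿ suc m ⊠ x ^ᴿ suc m ≈ x ^ᴿ suc m
    ^-absorb x = ≈-trans (solve 2 (λ x y → (x :* y) :* (x :* y) := (x :* (x :* y)) :* y) ≈-refl x (x ^ᴿ m)) (*-congʳ (^-fix x))

    -- The element x = x^(m+2) is a multiple of x².
    nilpotent-zero : ∀ x → x ⊠ x ≈ 0# → x ≈ 0#
    nilpotent-zero x eq = begin
      x                    ≈⟨ ^-fix x ⟨
      x ⊠ (x ⊠ x ^ᴿ m)     ≈⟨ *-assoc x x (x ^ᴿ m) ⟨
      (x ⊠ x) ⊠ x ^ᴿ m     ≈⟨ *-congʳ eq ⟩
      0# ⊠ x ^ᴿ m          ≈⟨ zeroˡ _ ⟩
      0#                   ∎

    -- Modulo the annihilator of e, either a vanishes or a^m is its inverse.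
    Resolves : K → K → Set
    Resolves e a = e ⊠ a ≈ 0# ⊎ e ⊠ a ^ᴿ suc m ≈ e

    resolves-multiple : ∀ {e e′ f a} → e ⊠ f ≈ e′ → Resolves e a → Resolves e′ a
    resolves-multiple {e} {e′} {f} {a} ef≈e′ (inj₁ ea≈0) = inj₁ (begin
      e′ ⊠ a       ≈⟨ *-congʳ ef≈e′ ⟨
      (e ⊠ f) ⊠ a  ≈⟨ solve 3 (λ e f a → (e :* f) :* a := f :* (e :* a)) ≈-refl e f a ⟩
      f ⊠ (e ⊠ a)  ≈⟨ *-congˡ ea≈0 ⟩
      f ⊠ 0#       ≈⟨ zeroʳ f ⟩
      0#           ∎)
    resolves-multiple {e} {e′} {f} {a} ef≈e′ (inj₂ eaᴺ≈e) = inj₂ (begin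
      e′ ⊠ a ^ᴿ suc m       ≈⟨ *-congʳ ef≈e′ ⟨
      (e ⊠ f) ⊠ a ^ᴿ suc m  ≈⟨ solve 3 (λ e f a → (e :* f) :* a := (e :* a) :* f) ≈-refl e f (a ^ᴿ suc m) ⟩
      (e ⊠ a ^ᴿ suc m) ⊠ f  ≈⟨ *-congʳ eaᴺ≈e ⟩
      e ⊠ f                 ≈⟨ ef≈e′ ⟩
      e′                    ∎)

    -- If e a ≉ 0 then a becomes invertible modulo the annihilator of
    -- e a^N with N = 2^(κ+1) − 1, and remains so for all multiples; hence one
    -- pass over all elements makes the residue ring a field.
    resolve : ∀ as e → e ≉ 0# → ∃[ e′ ] e′ ≉ 0# × (∃[ f ] e ⊠ f ≈ e′) × All (Resolves e′) as
    resolve []       e e≉0 = e , e≉0 , (1# , *-identityʳ e) , []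
    resolve (a ∷ as) e e≉0 with (e ⊠ a) ≈? 0#
    ... | yes ea≈0 =
      let e′ , e′≉0 , (f , ef≈e′) , resolved = resolve as e e≉0
      in e′ , e′≉0 , (f , ef≈e′) , resolves-multiple ef≈e′ (inj₁ ea≈0) ∷ resolved
    ... | no ea≉0 =
      let e′ , e′≉0 , (f , e₁f≈e′) , resolved = resolve as e₁ e₁≉0
      in e′ , e′≉0 , (a ^ᴿ suc m ⊠ f , ≈-trans (≈-sym (*-assoc e _ f)) e₁f≈e′) ,
         resolves-multiple e₁f≈e′ (inj₂ (≈-trans (*-assoc e _ _) (*-congˡ (^-absorb a)))) ∷ resolved
      where
      e₁ = e ⊠ a ^ᴿ suc m
      e₁≉0 : e₁ ≉ 0#
      e₁≉0 e₁≈0 = ea≉0 (begin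
        e ⊠ a                  ≈⟨ *-congˡ (^-fix a) ⟨
        e ⊠ (a ⊠ a ^ᴿ suc m)   ≈⟨ solve 3 (λ e a b → e :* (a :* b) := (e :* b) :* a) ≈-refl e a (a ^ᴿ suc m) ⟩
        e₁ ⊠ a                 ≈⟨ *-congʳ e₁≈0 ⟩
        0# ⊠ a                 ≈⟨ zeroˡ a ⟩
        0#                     ∎)

    -- The pass over all elements starts at the product G of the gaps and ends at a nonzero multiple
    -- e = G f. A gap g with e g = 0 divides G, so e is a multiple of g and e² = 0. Then e = 0,
    -- because there are no nilpotents.
    residueField : ∀ ξ → gaps ξ κ ≉ 0# → ∃[ e ] IsGaloisField (residueRing R e) κ
    residueField ξ G≉0 with resolve elements (gaps ξ κ) G≉0
    ... | e , e≉0 , (f , Gf≈e) , resolved = e , record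
      { 1+1≈0     = 1+1≈0ₑ
      ; _≈?_      = λ x y → (e ⊠ x) ≈? (e ⊠ y)
      ; 0≉1       = λ 0≈1 → e≉0 (≈-trans (≈-sym (*-identityʳ e)) (≈-trans (≈-sym 0≈1) (zeroʳ e)))
      ; inverse   = λ x → inverseₑ x (All.lookup resolved (complete x))
      ; frob-fix  = λ x → *-congˡ (≈-trans (reflexive (frobₑ≡frob (suc κ) x)) (frob-fix x))
      ; ξ         = ξ
      ; frob-move = move
      }
      where
      1+1≈0ₑ : CharacteristicTwo (residueRing R e)
      1+1≈0ₑ = *-congˡ 1+1≈0

      frobₑ : ℕ → K → K
      frobₑ = Frobenius.frob (residueRing R e) 1+1≈0ₑ

      frobₑ≡frob : ∀ i x → frobₑ i x ≡ frob i x
      frobₑ≡frob zero    x = refl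
      frobₑ≡frob (suc i) x = cong₂ _⊠_ (frobₑ≡frob i x) (frobₑ≡frob i x)

      inverseₑ : ∀ x → Resolves e x → e ⊠ x ≈ e ⊠ 0# ⊎ ∃[ y ] e ⊠ (x ⊠ y) ≈ e ⊠ 1#
      inverseₑ x (inj₁ ex≈0)  = inj₁ (≈-trans ex≈0 (≈-sym (zeroʳ e)))
      inverseₑ x (inj₂ exᴺ≈e) = inj₂ (x ^ᴿ m , ≈-trans exᴺ≈e (≈-sym (*-identityʳ e)))

      move : ∀ d → d < κ → ¬ e ⊠ frobₑ (suc d) ξ ≈ e ⊠ ξ
      move d d<κ eq = let h , gh≈G = gap∣gaps ξ d<κ; g = frob (suc d) ξ ⊞ ξ in
        e≉0 (nilpotent-zero e (begin
          e ⊠ e                    ≈⟨ *-congˡ (≈-trans (*-congʳ gh≈G) Gf≈e) ⟨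
          e ⊠ (g ⊠ h ⊠ f)          ≈⟨ solve 4 (λ e g h f → e :* (g :* h :* f) := (e :* g) :* (h :* f)) ≈-refl e g h f ⟩
          (e ⊠ g) ⊠ (h ⊠ f)        ≈⟨ *-congʳ (distribˡ e (frob (suc d) ξ) ξ) ⟩
          (e ⊠ frob (suc d) ξ ⊞ e ⊠ ξ) ⊠ (h ⊠ f)   ≈⟨ *-congʳ (≈⇒⊞-zero (≈-trans (*-congˡ (reflexive (sym (frobₑ≡frob (suc d) ξ)))) eq)) ⟩
          0# ⊠ (h ⊠ f)             ≈⟨ zeroˡ (h ⊠ f) ⟩
          0#                       ∎))

-- Degrees in the cyclic algebra and the construction of the field.

lastUnit : ∀ n → 𝔽₂^ suc n
lastUnit zero    = true ∷ []
lastUnit (suc n) = false ∷ lastUnit n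

final-lastUnit : ∀ b n → final b (lastUnit n) ≡ true
final-lastUnit b zero    = refl
final-lastUnit b (suc n) = final-lastUnit false n

push-lastUnit : ∀ n → push false (lastUnit n) ≡ 𝟎
push-lastUnit zero    = refl
push-lastUnit (suc n) = cong (false ∷_) (push-lastUnit n)

rotate-lastUnit : ∀ n → rotate (lastUnit n) ≡ 𝟏
rotate-lastUnit zero    = refl
rotate-lastUnit (suc n) = cong₂ _∷_ (final-lastUnit false n) (push-lastUnit n)

act-pad : ∀ {m n l} (p : 𝔽₂^ m) (v : 𝔽₂^ suc l) → m ≤ n → act (pad {n = n} p) v ≡ act p v
act-pad {n = zero}  []      v m≤n       = refl
act-pad {n = suc n} []      v m≤n       = act-𝟎ˡ (suc n) v
act-pad {n = suc n} (a ∷ p) v (s≤s m≤n) = cong (λ w → a · v ⊕ rotate w) (act-pad p v m≤n)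

module CyclicAlgebra (n : ℕ) where

  cyclic-1+1≈0 : CharacteristicTwo (cyclicAlgebra n)
  cyclic-1+1≈0 = ⊕-self 𝟏

  open Frobenius (cyclicAlgebra n) cyclic-1+1≈0

  X : 𝔽₂^ suc n
  X = rotate 𝟏

  X-act : ∀ v → X ⊠ v ≡ rotate v
  X-act v = trans (⊛-comm X v) (trans (act-rotate v 𝟏) (cong rotate (act-𝟏 v)))

  X^-lastUnit : ∀ i → act (lastUnit i) 𝟏 ≡ X ^ᴿ i
  X^-lastUnit zero    = trans (cong₂ _⊕_ (·-identityˡ 𝟏) rotate-𝟎) (⊕-identityʳ 𝟏)
  X^-lastUnit (suc i) = trans (cong₂ _⊕_ (·-zeroˡ (𝟏 {n})) (cong rotate (X^-lastUnit i)))
                              (trans (⊕-identityˡ _) (sym (X-act (X ^ᴿ i))))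

  X^n : X ^ᴿ n ≡ lastUnit n
  X^n = trans (sym (X^-lastUnit n)) (act-𝟏 (lastUnit n))

  X^[1+n] : X ^ᴿ suc n ≡ 𝟏
  X^[1+n] = trans (X-act (X ^ᴿ n)) (trans (cong rotate X^n) (rotate-lastUnit n))

  ·-𝟏 : ∀ b → b · 𝟏 {n} ≡ ⟦ b ⟧
  ·-𝟏 false = ·-zeroˡ 𝟏
  ·-𝟏 true  = ·-identityˡ 𝟏

  -- The algebra is generated by X over 𝔽₂, and a Frobenius power is a ring homomorphism fixing 𝔽₂.
  frob-fixes-act : ∀ i → frob i X ≡ X → ∀ {m} (p : 𝔽₂^ m) → frob i (act p 𝟏) ≡ act p 𝟏
  frob-fixes-act i fixX []      = frob-⟦⟧ i false
  frob-fixes-act i fixX (a ∷ p) = begin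
    frob i (a · 𝟏 ⊕ rotate w)              ≡⟨ frob-⊞ i (a · 𝟏) (rotate w) ⟩
    frob i (a · 𝟏) ⊕ frob i (rotate w)     ≡⟨ cong₂ _⊕_ (cong (frob i) (·-𝟏 a)) (cong (frob i) (sym (X-act w))) ⟩
    frob i ⟦ a ⟧ ⊕ frob i (X ⊠ w)          ≡⟨ cong₂ _⊕_ (trans (frob-⟦⟧ i a) (sym (·-𝟏 a))) (frob-⊠ i X w) ⟩
    a · 𝟏 ⊕ frob i X ⊠ frob i w            ≡⟨ cong (a · 𝟏 ⊕_) (cong₂ _⊠_ fixX (frob-fixes-act i fixX p)) ⟩
    a · 𝟏 ⊕ X ⊠ w                          ≡⟨ cong (a · 𝟏 ⊕_) (X-act w) ⟩
    a · 𝟏 ⊕ rotate w                       ∎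
    where
    open ≡-Reasoning
    w = act p 𝟏

  frob-fixes : ∀ i → frob i X ≡ X → ∀ v → frob i v ≡ v
  frob-fixes i fixX v = trans (cong (frob i) (sym (act-𝟏 v))) (trans (frob-fixes-act i fixX v) (act-𝟏 v))

  -- Having some representative of degree less than m. This restricts v only for m ≤ n.
  Degree< : ℕ → 𝔽₂^ suc n → Set
  Degree< m v = ∃[ p ] act {m} p 𝟏 ≡ v

  degree<-⊕ : ∀ {m u v} → Degree< m u → Degree< m v → Degree< m (u ⊕ v)
  degree<-⊕ (p , refl) (q , refl) = p ⊕ q , act-⊕ˡ p q 𝟏

  degree<-mono : ∀ {l m v} → l ≤ m → Degree< l v → Degree< m v
  degree<-mono l≤m (p , refl) = pad p , act-pad p 𝟏 l≤m

  degree<-X^ : ∀ m → Degree< (suc m) (X ^ᴿ m)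
  degree<-X^ m = lastUnit m , X^-lastUnit m

  degree<-X⊠ : ∀ {m v} → Degree< m v → Degree< (suc m) (X ⊠ v)
  degree<-X⊠ (p , refl) = false ∷ p ,
    trans (cong₂ _⊕_ (·-zeroˡ (𝟏 {n})) refl) (trans (⊕-identityˡ _) (sym (X-act (act p 𝟏))))

  degree<-X^⊠ : ∀ i {m v} → Degree< m v → Degree< (i + m) (X ^ᴿ i ⊠ v)
  degree<-X^⊠ zero    {v = v} low = subst (Degree< _) (sym (⊛-identityˡ v)) low
  degree<-X^⊠ (suc i) {v = v} low = subst (Degree< _) (sym (⊛-assoc X (X ^ᴿ i) v)) (degree<-X⊠ (degree<-X^⊠ i low))

  -- Degree n is detected by the last coordinate.
  X^n-not-degree< : ¬ Degree< n (X ^ᴿ n)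
  X^n-not-degree< (p , eq) with trans (sym (cong Vec.head (rotate-pad p ℕ.≤-refl)))
    (cong Vec.head (trans (cong rotate (trans (sym (act-𝟏-pad p (ℕ.n≤1+n n))) (trans eq X^n))) (rotate-lastUnit n)))
  ... | ()

  Monic : ℕ → 𝔽₂^ suc n → Set
  Monic m v = Degree< m (X ^ᴿ m ⊕ v)

  monic-nonzero : ∀ {v} → Monic n v → v ≢ 𝟎
  monic-nonzero monic refl = X^n-not-degree< (subst (Degree< n) (⊕-identityʳ (X ^ᴿ n)) monic)

  -- Write u = x^l + w with w of degree below l. Besides x^(l+m), the product u (x^m - x) consists
  -- of x^m w, x^(l+1) and x w. The inequality says m ≥ 2 and keeps the last two below degree l + m.
  monic-⊠ : ∀ {l m u} → Monic l u → suc (suc l) ≤ l + m → Monic (l + m) (u ⊠ (X ^ᴿ m ⊕ X))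
  monic-⊠ {l} {m} {u} low l+2≤l+m = subst (Degree< (l + m)) (sym identity)
    (degree<-⊕ (subst (λ k → Degree< k (X ^ᴿ m ⊠ w)) (ℕ.+-comm m l) (degree<-X^⊠ m low))
      (degree<-⊕ (degree<-mono l+2≤l+m (degree<-X^ (suc l)))
                 (degree<-mono (ℕ.≤-trans (ℕ.n≤1+n (suc l)) l+2≤l+m) (degree<-X⊠ low))))
    where
    w = X ^ᴿ l ⊕ u
    identity : X ^ᴿ (l + m) ⊕ u ⊠ (X ^ᴿ m ⊕ X) ≡ X ^ᴿ m ⊠ w ⊕ (X ^ᴿ suc l ⊕ X ⊠ w)
    identity = trans (cong (_⊕ u ⊠ (X ^ᴿ m ⊕ X)) (^ᴿ-+ X l m))
      (solve 4 (λ x xl xm u → xl :* xm :+ u :* (xm :+ x) := xm :* (xl :+ u) :+ (x :* xl :+ x :* (xl :+ u)))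
        refl X (X ^ᴿ l) (X ^ᴿ m) u)

  open ResidueField (cyclicAlgebra n) cyclic-1+1≈0 using (gaps)

  -- For n = `geometric κ` and d = κ the degree is n, the largest that is not reduced modulo x^(n+1)
  -- - 1, so the product is nonzero by `monic-nonzero`.
  gaps-monic : ∀ d → Monic (geometric d) (gaps X d)
  gaps-monic zero    = [] , sym (⊕-self 𝟏)
  gaps-monic (suc d) = subst (λ w → Monic (geometric (suc d)) (gaps X d ⊠ (w ⊕ X)))
    (sym (frob-^ (suc d) X))
    (monic-⊠ {geometric d} {2 ^ suc d} (gaps-monic d)
       (subst (_≤ geometric d + 2 ^ suc d) (ℕ.+-comm (geometric d) 2) (ℕ.+-monoʳ-≤ (geometric d) (ℕ.^-monoʳ-≤ 2 {1} {suc d} (s≤s z≤n)))))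

galoisField : ∀ κ → ∃[ R ] IsGaloisField R κ
galoisField κ = residueRing (cyclicAlgebra n) (proj₁ field′) , proj₂ field′
  where
  -- Then n + 1 = 2^(κ+1) - 1, so x^(n+1) = 1 gives x^(2^(κ+1)) = x.
  n = geometric κ
  open CyclicAlgebra n
  open Frobenius (cyclicAlgebra n) cyclic-1+1≈0

  fixX : frob (suc κ) X ≡ X
  fixX = begin
    frob (suc κ) X        ≡⟨ frob-^ (suc κ) X ⟩
    X ^ᴿ (2 ^ suc κ)      ≡⟨ cong (X ^ᴿ_) (2+geometric κ) ⟨
    X ⊠ X ^ᴿ suc n        ≡⟨ cong (X ⊠_) X^[1+n] ⟩
    X ⊠ 𝟏                 ≡⟨ act-𝟏 X ⟩
    X                     ∎
    where open ≡-Reasoning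

  field′ = ResidueField.residueField (cyclicAlgebra n) cyclic-1+1≈0 κ _≟ᵥ_
    (points (suc n)) points-complete (frob-fixes (suc κ) fixX) X (monic-nonzero (gaps-monic κ))

-- Finite quantifiers, and subspaces as images of additive maps.

∀? : ∀ {n} {P : 𝔽₂^ n → Set} → (∀ v → Dec (P v)) → Dec (∀ v → P v)
∀? P? = map′ (λ all v → All.lookup all (points-complete v)) (λ f → All.universal f _) (All.all? P? (points _))

∃? : ∀ {n} {P : 𝔽₂^ n → Set} → (∀ v → Dec (P v)) → Dec (∃[ v ] P v)
∃? P? = map′ Any.satisfied (λ (v , p) → lose (points-complete v) p) (Any.any? P? (points _))

-- Over 𝔽₂ this is linearity, since 0 and 1 are the only scalars.
Additive : ∀ {m n} → (𝔽₂^ m → 𝔽₂^ n) → Set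
Additive f = ∀ u v → f (u ⊕ v) ≡ f u ⊕ f v

module _ {m n} {f : 𝔽₂^ m → 𝔽₂^ n} (f-⊕ : Additive f) where

  additive-𝟎 : f 𝟎 ≡ 𝟎
  additive-𝟎 = begin
    f 𝟎              ≡⟨ ⊕-cancelˡ (f 𝟎) (f 𝟎) ⟨
    f 𝟎 ⊕ (f 𝟎 ⊕ f 𝟎) ≡⟨ cong (f 𝟎 ⊕_) (f-⊕ 𝟎 𝟎) ⟨
    f 𝟎 ⊕ f (𝟎 ⊕ 𝟎)  ≡⟨ cong (λ v → f 𝟎 ⊕ f v) (⊕-identityˡ 𝟎) ⟩
    f 𝟎 ⊕ f 𝟎        ≡⟨ ⊕-self (f 𝟎) ⟩
    𝟎                ∎
    where open ≡-Reasoning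

  additive-· : ∀ a v → f (a · v) ≡ a · f v
  additive-· false v = trans (cong f (·-zeroˡ v)) (trans additive-𝟎 (sym (·-zeroˡ (f v))))
  additive-· true  v = trans (cong f (·-identityˡ v)) (sym (·-identityˡ (f v)))

  additive-linearCombination : ∀ {d} (as : 𝔽₂^ d) vs →
    f (linearCombination as vs) ≡ linearCombination as (Vec.map f vs)
  additive-linearCombination []       []       = additive-𝟎
  additive-linearCombination (a ∷ as) (v ∷ vs) =
    trans (f-⊕ (a · v) (linearCombination as vs)) (cong₂ _⊕_ (additive-· a v) (additive-linearCombination as vs))

  image : Subspace n
  image = record
    { Carrier  = λ v → ∃[ u ] f u ≡ v
    ; 𝟎-closed = 𝟎 , additive-𝟎
    ; ⊕-closed = λ { (u , refl) (v , refl) → u ⊕ v , f-⊕ u v }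
    ; ·-closed = λ { a (u , refl) → a · u , additive-· a u }
    }

standardBasis : ∀ n → Vec (𝔽₂^ n) n
standardBasis zero    = []
standardBasis (suc n) = 𝟏 ∷ Vec.map (false ∷_) (standardBasis n)

linearCombination-standardBasis : ∀ {n} (as : 𝔽₂^ n) → linearCombination as (standardBasis n) ≡ as
linearCombination-standardBasis []               = refl
linearCombination-standardBasis {suc n} (a ∷ as) = begin
  a · 𝟏 ⊕ linearCombination as (Vec.map (false ∷_) (standardBasis n))   ≡⟨ cong (a · 𝟏 ⊕_) (additive-linearCombination {f = false ∷_} (λ _ _ → refl) as (standardBasis n)) ⟨
  a · 𝟏 ⊕ (false ∷ linearCombination as (standardBasis n))              ≡⟨ cong₂ (λ u v → u ⊕ (false ∷ v)) (cong₂ _∷_ (Bool.∧-identityʳ a) (·-zeroʳ a)) (linearCombination-standardBasis as) ⟩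
  (a xor false) ∷ (𝟎 ⊕ as)                                              ≡⟨ cong₂ _∷_ (Bool.xor-identityʳ a) (⊕-identityˡ as) ⟩
  a ∷ as                                                                ∎
  where open ≡-Reasoning

image-dimension : ∀ {m n} {f : 𝔽₂^ m → 𝔽₂^ n} (f-⊕ : Additive f) →
  (∀ u → f u ≡ 𝟎 → u ≡ 𝟎) → HasDimension m (image f-⊕)
image-dimension {m} {f = f} f-⊕ kernel = basis , record
  { members     = VecAll.map⁺ (VecAll.universal (λ u → u , refl) (standardBasis m))
  ; independent = λ as eq → kernel as (trans (sym (combination as)) eq)
  ; spanning    = λ { (u , refl) → u , combination u }
  }
  where
  basis = Vec.map f (standardBasis m)
  combination : ∀ as → linearCombination as basis ≡ f as
  combination as = trans (sym (additive-linearCombination f-⊕ as (standardBasis m)))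
                         (cong f (linearCombination-standardBasis as))

linearCombination-⊕ : ∀ {n d} (vs : Vec (𝔽₂^ n) d) → Additive (λ as → linearCombination as vs)
linearCombination-⊕ []       []       []       = sym (⊕-identityˡ 𝟎)
linearCombination-⊕ (v ∷ vs) (a ∷ as) (b ∷ bs) = trans
  (cong₂ _⊕_ (·-distribʳ-xor v a b) (linearCombination-⊕ vs as bs))
  (⊕-interchange (a · v) (b · v) (linearCombination as vs) (linearCombination bs vs))

span : ∀ {n d} → Vec (𝔽₂^ n) d → Subspace n
span vs = image (linearCombination-⊕ vs)

span⊆ : ∀ {n d} (U : Subspace n) {vs : Vec (𝔽₂^ n) d} → VecAll.All (Unary._∈ Carrier U) vs →
  ∀ as → linearCombination as vs Unary.∈ Carrier U
span⊆ U VecAll.[]              []       = Subspace.𝟎-closed U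
span⊆ U (v∈U VecAll.∷ vs⊆U) (a ∷ as) = Subspace.⊕-closed U (Subspace.·-closed U a v∈U) (span⊆ U vs⊆U as)

-- Existence of the covering number by finite search.

least : ∀ {p} {P : ℕ → Set p} → (∀ n → Dec (P n)) → ∀ {b} → P b →
  ∃[ m ] (P m × (∀ j → P j → m ≤ j)) × m ≤ b
least {P = P} P? {b} pb with search (suc b)
  where
  search : ∀ b → (∃[ m ] (P m × (∀ j → P j → m ≤ j)) × m < b) ⊎ (∀ j → j < b → ¬ P j)
  search zero = inj₂ λ _ ()
  search (suc b) with search b
  ... | inj₁ (m , least , m<b) = inj₁ (m , least , ℕ.m≤n⇒m≤1+n m<b)
  ... | inj₂ none with P? b
  ...   | yes pb = inj₁ (b , (pb , λ j pj → ℕ.≮⇒≥ (λ j<b → none j j<b pj)) , ℕ.≤-refl)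
  ...   | no ¬pb = inj₂ λ j j<1+b pj → [ (λ j<b → none j j<b pj) , (λ { refl → ¬pb pj }) ]′ (ℕ.m≤n⇒m<n∨m≡n (ℕ.≤-pred j<1+b))
... | inj₁ (m , isLeast , s≤s m≤b) = m , isLeast , m≤b
... | inj₂ none = ⊥-elim (none b ℕ.≤-refl pb)

module _ {n : ℕ} where

  CoversPair : (w₁ w₂ : 𝔽₂^ n) → Subspace n → Set
  CoversPair w₁ w₂ U = Carrier U w₁ × Carrier U w₂

  -- A subspace contains W once it contains a basis of W. Together with the converse below, this
  -- replaces the quantifier over subspaces by one over finitely many pairs.
  pairs⇒covering : ∀ {𝒞} →
    (∀ w₁ w₂ → LinearlyIndependent (w₁ ∷ w₂ ∷ []) → Any (CoversPair w₁ w₂) 𝒞) →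
    ∀ W → HasDimension 2 W → Any (λ U → Carrier W Unary.⊆ Carrier U) 𝒞
  pairs⇒covering pairs W (w₁ ∷ w₂ ∷ [] , basis) = Any.map (λ {U} → W⊆ {U}) (pairs w₁ w₂ (IsBasis.independent basis))
    where
    W⊆ : ∀ {U} → CoversPair w₁ w₂ U → Carrier W Unary.⊆ Carrier U
    W⊆ {U} (w₁∈U , w₂∈U) w∈W =
      let as , eq = IsBasis.spanning basis w∈W
      in subst (Carrier U) eq (span⊆ U (w₁∈U VecAll.∷ w₂∈U VecAll.∷ VecAll.[]) as)

  covering⇒pairs : ∀ {𝒞} →
    (∀ W → HasDimension 2 W → Any (λ U → Carrier W Unary.⊆ Carrier U) 𝒞) →
    ∀ w₁ w₂ → LinearlyIndependent (w₁ ∷ w₂ ∷ []) → Any (CoversPair w₁ w₂) 𝒞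
  covering⇒pairs covering w₁ w₂ independent = Any.map (λ W⊆U → W⊆U w₁∈W , W⊆U w₂∈W)
    (covering W (image-dimension (linearCombination-⊕ (w₁ ∷ w₂ ∷ [])) independent))
    where
    W = span (w₁ ∷ w₂ ∷ [])
    w₁∈W : Carrier W w₁
    w₁∈W = true ∷ false ∷ [] , trans (cong₂ _⊕_ (·-identityˡ w₁) (trans (⊕-identityʳ _) (·-zeroˡ w₂))) (⊕-identityʳ w₁)
    w₂∈W : Carrier W w₂
    w₂∈W = false ∷ true ∷ [] , trans (cong₂ _⊕_ (·-zeroˡ w₁) (trans (⊕-identityʳ _) (·-identityˡ w₂))) (⊕-identityˡ w₂)

  linearlyIndependent? : ∀ {d} (vs : Vec (𝔽₂^ n) d) → Dec (LinearlyIndependent vs)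
  linearlyIndependent? vs = ∀? λ as → (linearCombination as vs ≟ᵥ 𝟎) →-dec (as ≟ᵥ 𝟎)

module _ {n k : ℕ} where

  Bases : Set
  Bases = List (Vec (𝔽₂^ n) k)

  -- The carrier of a `Subspace` is an arbitrary predicate, hence not searchable. Passing to bases
  -- turns a design into finite data with a decidable condition.
  IsDesignBases : Bases → Set
  IsDesignBases ds = All LinearlyIndependent ds ×
    (∀ w₁ w₂ → LinearlyIndependent (w₁ ∷ w₂ ∷ []) → Any (CoversPair w₁ w₂ ∘ span) ds)

  isDesignBases? : ∀ ds → Dec (IsDesignBases ds)
  isDesignBases? ds = All.all? linearlyIndependent? ds ×-dec
    (∀? λ w₁ → ∀? λ w₂ → linearlyIndependent? (w₁ ∷ w₂ ∷ []) →-dec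
      Any.any? (λ d → (∃? λ as → linearCombination as d ≟ᵥ w₁) ×-dec (∃? λ as → linearCombination as d ≟ᵥ w₂)) ds)

  bases : ∀ {𝒞} → All (HasDimension k) 𝒞 → Bases
  bases = All.reduce proj₁

  length-bases : ∀ {𝒞} (dims : All (HasDimension k) 𝒞) → length (bases dims) ≡ length 𝒞
  length-bases []           = refl
  length-bases (_ ∷ dims) = cong suc (length-bases dims)

  bases-independent : ∀ {𝒞} (dims : All (HasDimension k) 𝒞) → All LinearlyIndependent (bases dims)
  bases-independent []             = []
  bases-independent ((_ , b) ∷ dims) = IsBasis.independent b ∷ bases-independent dims

  bases-covers : ∀ {𝒞} (dims : All (HasDimension k) 𝒞) {w₁ w₂} →
    Any (CoversPair w₁ w₂) 𝒞 → Any (CoversPair w₁ w₂ ∘ span) (bases dims)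
  bases-covers ((_ , b) ∷ dims) (here (w₁∈U , w₂∈U)) = here (IsBasis.spanning b w₁∈U , IsBasis.spanning b w₂∈U)
  bases-covers (_ ∷ dims)       (there covered)      = there (bases-covers dims covered)

  DesignOfSize : ℕ → Set₁
  DesignOfSize l = ∃[ 𝒞 ] IsCoveringDesign₂ n k 2 𝒞 × length 𝒞 ≡ l

  BasesOfSize : ℕ → Set
  BasesOfSize l = ∃[ ds ] IsDesignBases (Vec.toList {n = l} ds)

  bases⇒design : ∀ {l} → BasesOfSize l → DesignOfSize l
  bases⇒design (ds , independent , covers) = List.map span (Vec.toList ds) , record
      { dimension = All.map⁺ (All.map (λ {d} → image-dimension (linearCombination-⊕ d)) independent)
      ; covering  = pairs⇒covering λ w₁ w₂ li → Any.map⁺ (covers w₁ w₂ li)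
      } , trans (List.length-map span (Vec.toList ds)) (Vec.length-toList ds)

  design⇒bases : ∀ {l} → DesignOfSize l → BasesOfSize l
  design⇒bases (𝒞 , design , refl) = subst BasesOfSize (length-bases dimension)
    (Vec.fromList (bases dimension) , subst IsDesignBases (sym (Vec.toList∘fromList (bases dimension)))
      (bases-independent dimension , λ w₁ w₂ li → bases-covers dimension (covering⇒pairs covering w₁ w₂ li)))
    where open IsCoveringDesign₂ design

  designOfSize? : ∀ l → Dec (DesignOfSize l)
  designOfSize? l = map′ (bases⇒design ∘ Any.satisfied)
    (λ design → let ds , good = design⇒bases design in lose (vectors-complete (vectors-complete points-complete) ds) good)
    (Any.any? (isDesignBases? ∘ Vec.toList) (vectors (vectors (points n) k) l))

  coveringNumber : ∀ 𝒞 → IsCoveringDesign₂ n k 2 𝒞 → ∃[ m ] IsCoveringNumber₂ n k 2 m × m ≤ length 𝒞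
  coveringNumber 𝒞 design =
    let m , (attained , minimal) , m≤ = least designOfSize? (𝒞 , design , refl) in
    m , record { attained = attained ; minimal = λ 𝒟 design′ → minimal (length 𝒟) (𝒟 , design′ , refl) } , m≤

-- Nonzero vectors and hyperplanes.

nonzeroPoints : ∀ n → List (𝔽₂^ n)
nonzeroPoints zero    = []
nonzeroPoints (suc n) = List.map (true ∷_) (points n) List.++ List.map (false ∷_) (nonzeroPoints n)

nonzeroPoints-complete : ∀ {n} (v : 𝔽₂^ n) → v ≢ 𝟎 → v ∈ nonzeroPoints n
nonzeroPoints-complete []          v≢𝟎 = ⊥-elim (v≢𝟎 refl)
nonzeroPoints-complete (true  ∷ v) v≢𝟎 = ∈-++⁺ˡ (∈-map⁺ (true ∷_) (points-complete v))
nonzeroPoints-complete (false ∷ v) v≢𝟎 = ∈-++⁺ʳ (List.map (true ∷_) (points _))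
  (∈-map⁺ (false ∷_) (nonzeroPoints-complete v (λ v≡𝟎 → v≢𝟎 (cong (false ∷_) v≡𝟎))))

nonzeroPoints-nonzero : ∀ n → All (_≢ 𝟎) (nonzeroPoints n)
nonzeroPoints-nonzero zero    = []
nonzeroPoints-nonzero (suc n) = All.++⁺
  (All.map⁺ (All.universal (λ _ ()) (points n)))
  (All.map⁺ (All.map (λ v≢𝟎 eq → v≢𝟎 (Vec.∷-injectiveʳ eq)) (nonzeroPoints-nonzero n)))

length-nonzeroPoints : ∀ n → suc (length (nonzeroPoints n)) ≡ 2 ^ n
length-nonzeroPoints zero    = refl
length-nonzeroPoints (suc n) = begin
  suc (length (List.map (true ∷_) (points n) List.++ List.map (false ∷_) (nonzeroPoints n)))
    ≡⟨ cong suc (List.length-++ (List.map (true ∷_) (points n))) ⟩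
  suc (length (List.map (true ∷_) (points n)) + length (List.map (false ∷_) (nonzeroPoints n)))
    ≡⟨ cong suc (cong₂ _+_ (List.length-map (true ∷_) (points n)) (List.length-map (false ∷_) (nonzeroPoints n))) ⟩
  suc (length (points n) + length (nonzeroPoints n))
    ≡⟨ ℕ.+-suc (length (points n)) (length (nonzeroPoints n)) ⟨
  length (points n) + suc (length (nonzeroPoints n))
    ≡⟨ cong₂ _+_ (length-vectors bits n) (trans (length-nonzeroPoints n) (sym (ℕ.+-identityʳ (2 ^ n)))) ⟩
  2 ^ suc n ∎
  where open ≡-Reasoning

dot : ∀ {n} → 𝔽₂^ n → 𝔽₂^ n → 𝔽₂
dot []      []      = false
dot (a ∷ u) (b ∷ v) = (a ∧ b) xor dot u v

dot-𝟎ˡ : ∀ {n} (v : 𝔽₂^ n) → dot 𝟎 v ≡ false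
dot-𝟎ˡ []      = refl
dot-𝟎ˡ (b ∷ v) = dot-𝟎ˡ v

dot-⊕ʳ : ∀ {n} (w u v : 𝔽₂^ n) → dot w (u ⊕ v) ≡ dot w u xor dot w v
dot-⊕ʳ []      []      []      = refl
dot-⊕ʳ (c ∷ w) (a ∷ u) (b ∷ v) = begin
  (c ∧ (a xor b)) xor dot w (u ⊕ v)                    ≡⟨ cong₂ _xor_ (Bool.∧-distribˡ-xor c a b) (dot-⊕ʳ w u v) ⟩
  ((c ∧ a) xor (c ∧ b)) xor (dot w u xor dot w v)      ≡⟨ cong Vec.head (⊕-interchange (c ∧ a ∷ []) (c ∧ b ∷ []) (dot w u ∷ []) (dot w v ∷ [])) ⟩
  ((c ∧ a) xor dot w u) xor ((c ∧ b) xor dot w v)      ∎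
  where open ≡-Reasoning

-- Parametrises the hyperplane dot w v = 0, provided that w ≢ 𝟎.
hyperplane : ∀ {n} → 𝔽₂^ suc n → 𝔽₂^ n → 𝔽₂^ suc n
hyperplane         (true  ∷ w) v       = dot w v ∷ v
hyperplane {zero}  (false ∷ w) v       = false ∷ v
hyperplane {suc n} (false ∷ w) (b ∷ v) = b ∷ hyperplane w v

hyperplane-⊕ : ∀ {n} (w : 𝔽₂^ suc n) → Additive (hyperplane w)
hyperplane-⊕         (true  ∷ w) u       v       = cong (_∷ u ⊕ v) (dot-⊕ʳ w u v)
hyperplane-⊕ {zero}  (false ∷ w) u       v       = refl
hyperplane-⊕ {suc n} (false ∷ w) (a ∷ u) (b ∷ v) = cong ((a xor b) ∷_) (hyperplane-⊕ w u v)

hyperplane-kernel : ∀ {n} (w : 𝔽₂^ suc n) v → hyperplane w v ≡ 𝟎 → v ≡ 𝟎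
hyperplane-kernel         (true  ∷ w) v       eq = Vec.∷-injectiveʳ eq
hyperplane-kernel {zero}  (false ∷ w) v       eq = Vec.∷-injectiveʳ eq
hyperplane-kernel {suc n} (false ∷ w) (b ∷ v) eq = cong₂ _∷_ (Vec.∷-injectiveˡ eq) (hyperplane-kernel w v (Vec.∷-injectiveʳ eq))

xor-false⇒≡ : ∀ {a b} → a xor b ≡ false → b ≡ a
xor-false⇒≡ {false}        eq = eq
xor-false⇒≡ {true} {true}  eq = refl

-- At the first nonzero entry of w the equation determines that coordinate of u from the later ones.
-- Deleting it gives the preimage.
hyperplane-surjective : ∀ {n} (w u : 𝔽₂^ suc n) → w ≢ 𝟎 → dot w u ≡ false → ∃[ v ] hyperplane w v ≡ u
hyperplane-surjective         (true  ∷ w)  (b ∷ u) w≢𝟎 eq = u , cong (_∷ u) (xor-false⇒≡ eq)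
hyperplane-surjective {zero}  (false ∷ []) u       w≢𝟎 eq = ⊥-elim (w≢𝟎 refl)
hyperplane-surjective {suc n} (false ∷ w)  (b ∷ u) w≢𝟎 eq =
  let v , eq′ = hyperplane-surjective w u (λ w≡𝟎 → w≢𝟎 (cong (false ∷_) w≡𝟎)) eq
  in b ∷ v , cong (b ∷_) eq′

-- Two homogeneous linear equations in three unknowns have a nonzero solution. Over 𝔽₂ there are
-- only 64 pairs of equations to check.
orthogonal? : Dec (∀ (a b : 𝔽₂^ 3) → ∃[ c ] c ≢ 𝟎 × dot c a ≡ false × dot c b ≡ false)
orthogonal? = ∀? λ a → ∀? λ b → ∃? λ c →
  ¬? (c ≟ᵥ 𝟎) ×-dec (dot c a Bool.≟ false) ×-dec (dot c b Bool.≟ false)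

abstract
  orthogonal : ∀ (a b : 𝔽₂^ 3) → ∃[ c ] c ≢ 𝟎 × dot c a ≡ false × dot c b ≡ false
  orthogonal = from-yes orthogonal?

-- Graphs, and hyperplanes of S + ⟨Q⟩.

++-⊕ : ∀ {m n} (u u′ : 𝔽₂^ m) (v v′ : 𝔽₂^ n) → (u ⊕ u′) ++ (v ⊕ v′) ≡ (u ++ v) ⊕ (u′ ++ v′)
++-⊕ u u′ v v′ = sym (Vec.zipWith-++ _xor_ u v u′ v′)

𝟎++𝟎 : ∀ m {n} → 𝟎 {m + n} ≡ 𝟎 {m} ++ 𝟎
𝟎++𝟎 zero    = refl
𝟎++𝟎 (suc m) = cong (false ∷_) (𝟎++𝟎 m)

++-kernel : ∀ {m n} (u : 𝔽₂^ m) (v : 𝔽₂^ n) → u ++ v ≡ 𝟎 → u ≡ 𝟎 × v ≡ 𝟎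
++-kernel {m} u v eq = Vec.++-injective u 𝟎 (trans eq (𝟎++𝟎 m))

module _ {k} (f : 𝔽₂^ k → 𝔽₂^ k) (f-⊕ : Additive f) where

  graph-⊕ : Additive (λ x → x ++ f x)
  graph-⊕ x y = trans (cong (x ⊕ y ++_) (f-⊕ x y)) (++-⊕ x y (f x) (f y))

  graph : Subspace (k + k)
  graph = image graph-⊕

  graph-dimension : HasDimension k graph
  graph-dimension = image-dimension graph-⊕ (λ x eq → proj₁ (++-kernel x (f x) eq))

-- The hyperplane c t + ⟨l , s⟩ = 0, with w = c ∷ l, of the space of all
-- tQ ++ s.
module _ {k} (Q : 𝔽₂^ k) (w : 𝔽₂^ suc k) where

  extend : 𝔽₂^ suc k → 𝔽₂^ (k + k)
  extend (t ∷ s) = t · Q ++ s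

  extend-⊕ : Additive extend
  extend-⊕ (t ∷ s) (t′ ∷ s′) = trans (cong (_++ (s ⊕ s′)) (·-distribʳ-xor Q t t′)) (++-⊕ (t · Q) (t′ · Q) s s′)

  extend-kernel : Q ≢ 𝟎 → ∀ v → extend v ≡ 𝟎 → v ≡ 𝟎
  extend-kernel Q≢𝟎 (false ∷ s) eq = cong (false ∷_) (proj₂ (++-kernel (false · Q) s eq))
  extend-kernel Q≢𝟎 (true  ∷ s) eq = ⊥-elim (Q≢𝟎 (trans (sym (·-identityˡ Q)) (proj₁ (++-kernel (true · Q) s eq))))

  section-⊕ : Additive (extend ∘ hyperplane w)
  section-⊕ u v = trans (cong extend (hyperplane-⊕ w u v)) (extend-⊕ (hyperplane w u) (hyperplane w v))

  section : Subspace (k + k)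
  section = image section-⊕

  section-dimension : Q ≢ 𝟎 → HasDimension k section
  section-dimension Q≢𝟎 = image-dimension section-⊕
    (λ v eq → hyperplane-kernel w v (extend-kernel Q≢𝟎 (hyperplane w v) eq))

  ∈-section : w ≢ 𝟎 → ∀ t s → dot w (t ∷ s) ≡ false → Carrier section (t · Q ++ s)
  ∈-section w≢𝟎 t s eq = let v , eq′ = hyperplane-surjective w (t ∷ s) w≢𝟎 eq in v , cong extend eq′

  ∈-section₀ : w ≢ 𝟎 → ∀ s → dot w (false ∷ s) ≡ false → Carrier section (𝟎 ++ s)
  ∈-section₀ w≢𝟎 s eq = subst (λ x → Carrier section (x ++ s)) (·-zeroˡ Q) (∈-section w≢𝟎 false s eq)

-- The c ∷ l with l nonzero: two choices of c and three of l give the six hyperplanes for each Q.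
-- For l = 0 the form with c = 1 would define S itself.
triples : List (𝔽₂^ 3)
triples = cartesianProductWith _∷_ bits (nonzeroPoints 2)

-- The sections belonging to all Q, and the 2-spaces that they cover.

module _ {j : ℕ} where

  private
    k = suc (suc (suc j))

  -- A point of the projective line over 𝔽₂, which selects the plane of forms used for Q. The
  -- default (1 , 0) replaces the pair of zeros, which is not such a point.
  direction : 𝔽₂^ k → 𝔽₂ × 𝔽₂
  direction (false ∷ false ∷ _) = true , false
  direction (p ∷ q ∷ _)         = p , q

  direction-nonzero : ∀ Q → direction Q ≢ (false , false)
  direction-nonzero (false ∷ false ∷ _) ()
  direction-nonzero (false ∷ true ∷ _)  ()
  direction-nonzero (true ∷ _ ∷ _)      ()

  -- For fixed Q the forms l with weights Q _ = c ∷ l make up a plane in the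
  -- dual space; these planes contain the third coordinate form and together
  -- all combinations of the first three coordinate forms.
  weights : 𝔽₂^ k → 𝔽₂^ 3 → 𝔽₂^ suc k
  weights Q (c ∷ α ∷ γ ∷ []) = c ∷ α ∧ proj₁ (direction Q) ∷ α ∧ proj₂ (direction Q) ∷ γ ∷ 𝟎

  weights-nonzero : ∀ Q c {l} → l ≢ 𝟎 → weights Q (c ∷ l) ≢ 𝟎
  weights-nonzero Q c {true  ∷ γ     ∷ []} l≢𝟎 eq =
    direction-nonzero Q (cong₂ _,_ (cong (λ w → Vec.head (Vec.tail w)) eq) (cong (λ w → Vec.head (Vec.tail (Vec.tail w))) eq))
  weights-nonzero Q c {false ∷ true  ∷ []} l≢𝟎 ()
  weights-nonzero Q c {false ∷ false ∷ []} l≢𝟎 eq = l≢𝟎 refl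

  -- The adjoint of `weights Q`: these three coordinates decide membership in all six hyperplanes
  -- for Q.
  compress : 𝔽₂^ k → 𝔽₂^ suc k → 𝔽₂^ 3
  compress Q (t ∷ s₁ ∷ s₂ ∷ s₃ ∷ _) =
    t ∷ ((proj₁ (direction Q) ∧ s₁) xor (proj₂ (direction Q) ∧ s₂)) ∷ s₃ ∷ []

  dot-weights : ∀ Q τ v → dot (weights Q τ) v ≡ dot τ (compress Q v)
  dot-weights Q (c ∷ false ∷ γ ∷ []) (t ∷ s₁ ∷ s₂ ∷ s₃ ∷ r) =
    cong (λ b → (c ∧ t) xor ((γ ∧ s₃) xor b)) (dot-𝟎ˡ r)
  dot-weights Q (c ∷ true  ∷ γ ∷ []) (t ∷ s₁ ∷ s₂ ∷ s₃ ∷ r) = trans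
    (cong (λ b → (c ∧ t) xor ((p ∧ s₁) xor ((q ∧ s₂) xor ((γ ∧ s₃) xor b)))) (dot-𝟎ˡ r))
    (cong ((c ∧ t) xor_) (sym (Bool.xor-assoc (p ∧ s₁) (q ∧ s₂) ((γ ∧ s₃) xor false))))
    where
    p = proj₁ (direction Q)
    q = proj₂ (direction Q)

  sections : List (Subspace (k + k))
  sections = cartesianProductWith (λ Q τ → section Q (weights Q τ)) (nonzeroPoints k) triples

  length-sections : length sections ≡ length (nonzeroPoints k) * 6
  length-sections = length-cartesianProductWith (λ Q τ → section Q (weights Q τ)) (nonzeroPoints k) triples

  sections-dimension : All (HasDimension k) sections
  sections-dimension = All.cartesianProductWith⁺ (≡-setoid _) (≡-setoid _) _ (nonzeroPoints k) triples
    (λ {Q} {τ} Q∈ _ → section-dimension Q (weights Q τ) (All.lookup (nonzeroPoints-nonzero k) Q∈))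

  Any-sections : ∀ {P : Subspace (k + k) → Set} Q c l → Q ≢ 𝟎 → l ≢ 𝟎 →
    P (section Q (weights Q (c ∷ l))) → Any P sections
  Any-sections {P} Q c l Q≢𝟎 l≢𝟎 p = Any.cartesianProductWith⁺ (λ Q τ → section Q (weights Q τ)) {P = Q ≡_} {Q = (c ∷ l) ≡_}
    (λ { refl refl → p })
    (nonzeroPoints-complete Q Q≢𝟎)
    (∈-cartesianProductWith⁺ _∷_ (bits-complete c) (nonzeroPoints-complete l l≢𝟎))

  -- The two compressed vectors have a common nonzero orthogonal c ∷ l in 𝔽₂³. If l were 0, then c =
  -- 1 and t₁ = t₂ = 0, so both vectors would lie in S.
  sections-cover-collinear : ∀ Q → Q ≢ 𝟎 → ∀ t₁ t₂ → (t₁ ∷ t₂ ∷ []) ≢ 𝟎 → ∀ s₁ s₂ →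
    Any (CoversPair (t₁ · Q ++ s₁) (t₂ · Q ++ s₂)) sections
  sections-cover-collinear Q Q≢𝟎 t₁ t₂ t≢𝟎 s₁ s₂
    with orthogonal (compress Q (t₁ ∷ s₁)) (compress Q (t₂ ∷ s₂))
  ... | c ∷ l , τ≢𝟎 , eq₁ , eq₂ = Any-sections Q c l Q≢𝟎 l≢𝟎
      (∈-section Q w w≢𝟎 t₁ s₁ (trans (dot-weights Q (c ∷ l) (t₁ ∷ s₁)) eq₁) ,
       ∈-section Q w w≢𝟎 t₂ s₂ (trans (dot-weights Q (c ∷ l) (t₂ ∷ s₂)) eq₂))
    where
    w = weights Q (c ∷ l)
    degenerate : ∀ c (s₁ s₂ : 𝔽₂^ k) → (c ∷ 𝟎) ≢ 𝟎 {3} →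
      dot (c ∷ 𝟎) (compress Q (t₁ ∷ s₁)) ≡ false → dot (c ∷ 𝟎) (compress Q (t₂ ∷ s₂)) ≡ false → ⊥
    degenerate false s₁ s₂ c≢𝟎 eq₁ eq₂ = c≢𝟎 refl
    degenerate true (_ ∷ _ ∷ _ ∷ _) (_ ∷ _ ∷ _ ∷ _) c≢𝟎 eq₁ eq₂ =
      t≢𝟎 (cong₂ (λ a b → a ∷ b ∷ []) (sym (xor-false⇒≡ eq₁)) (sym (xor-false⇒≡ eq₂)))
    l≢𝟎 : l ≢ 𝟎
    l≢𝟎 refl = degenerate c s₁ s₂ τ≢𝟎 eq₁ eq₂
    w≢𝟎 = weights-nonzero Q c l≢𝟎

  firstThree : 𝔽₂^ k → 𝔽₂^ 3
  firstThree (s₁ ∷ s₂ ∷ s₃ ∷ _) = s₁ ∷ s₂ ∷ s₃ ∷ []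

  -- If the first two coefficients of l are not both zero, they serve as the first two coordinates
  -- of Q, and `direction Q` returns them. Otherwise l is the third coordinate form, which belongs
  -- to the plane of every Q.
  realise : ∀ l → l ≢ 𝟎 → ∃[ Q ] ∃[ m ] Q ≢ 𝟎 × m ≢ 𝟎 ×
    (∀ s → dot (weights Q (false ∷ m)) (false ∷ s) ≡ dot l (firstThree s))
  realise (false ∷ false ∷ false ∷ []) l≢𝟎 = ⊥-elim (l≢𝟎 refl)
  realise (false ∷ false ∷ true  ∷ []) l≢𝟎 = 𝟏 , false ∷ true ∷ [] , (λ ()) , (λ ()) ,
    λ { s@(_ ∷ _ ∷ _ ∷ _) → dot-weights 𝟏 (false ∷ false ∷ true ∷ []) (false ∷ s) }
  realise (false ∷ true  ∷ l₃    ∷ []) l≢𝟎 = Q , true ∷ l₃ ∷ [] , (λ ()) , (λ ()) ,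
    λ { s@(_ ∷ _ ∷ _ ∷ _) → dot-weights Q (false ∷ true ∷ l₃ ∷ []) (false ∷ s) }
    where Q = false ∷ true ∷ 𝟎
  realise (true  ∷ l₂    ∷ l₃    ∷ []) l≢𝟎 = Q , true ∷ l₃ ∷ [] , (λ ()) , (λ ()) ,
    λ { s@(s₁ ∷ s₂ ∷ _ ∷ _) → trans (dot-weights Q (false ∷ true ∷ l₃ ∷ []) (false ∷ s)) (Bool.xor-assoc s₁ (l₂ ∧ s₂) _) }
    where Q = true ∷ l₂ ∷ 𝟎

  -- Some nonzero combination of the first three coordinate forms of S vanishes at s₁ and s₂. By
  -- `realise` it is the restriction to S of a form defining one of the sections.
  sections-cover-vertical : ∀ s₁ s₂ → Any (CoversPair (𝟎 {k} ++ s₁) (𝟎 {k} ++ s₂)) sections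
  sections-cover-vertical s₁ s₂ with orthogonal (firstThree s₁) (firstThree s₂)
  ... | l , l≢𝟎 , eq₁ , eq₂ with realise l l≢𝟎
  ... | Q , m , Q≢𝟎 , m≢𝟎 , dot≡ = Any-sections Q false m Q≢𝟎 m≢𝟎
    (∈-section₀ Q w w≢𝟎 s₁ (trans (dot≡ s₁) eq₁) , ∈-section₀ Q w w≢𝟎 s₂ (trans (dot≡ s₂) eq₂))
    where
    w = weights Q (false ∷ m)
    w≢𝟎 = weights-nonzero Q false m≢𝟎

-- The covering design and its size.

module CoveringDesign {j : ℕ}
  (φ : (a b x : 𝔽₂^ (3 + j)) → 𝔽₂^ (3 + j))
  (φ-⊕ : ∀ a b → Additive (φ a b))
  (φ-interpolate : ∀ {x y} → x ≢ 𝟎 → y ≢ 𝟎 → x ≢ y → ∀ u v → ∃[ a ] ∃[ b ] φ a b x ≡ u × φ a b y ≡ v) where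

  private
    k = 3 + j

  graphs : List (Subspace (k + k))
  graphs = cartesianProductWith (λ a b → graph (φ a b) (φ-⊕ a b)) (points k) (points k)

  length-graphs : length graphs ≡ length (points k) * length (points k)
  length-graphs = length-cartesianProductWith (λ a b → graph (φ a b) (φ-⊕ a b)) (points k) (points k)

  graphs-dimension : All (HasDimension k) graphs
  graphs-dimension = All.cartesianProductWith⁺ (≡-setoid _) (≡-setoid _) _ (points k) (points k)
    (λ {a} {b} _ _ → graph-dimension (φ a b) (φ-⊕ a b))

  graphs-cover : ∀ {x₁ x₂} → x₁ ≢ 𝟎 → x₂ ≢ 𝟎 → x₁ ≢ x₂ → ∀ s₁ s₂ →
    Any (CoversPair (x₁ ++ s₁) (x₂ ++ s₂)) graphs
  graphs-cover {x₁} {x₂} x₁≢𝟎 x₂≢𝟎 x₁≢x₂ s₁ s₂ with φ-interpolate x₁≢𝟎 x₂≢𝟎 x₁≢x₂ s₁ s₂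
  ... | a , b , eq₁ , eq₂ = Any.cartesianProductWith⁺ (λ a b → graph (φ a b) (φ-⊕ a b)) {P = a ≡_} {Q = b ≡_}
    (λ { refl refl → (x₁ , cong (x₁ ++_) eq₁) , (x₂ , cong (x₂ ++_) eq₂) })
    (points-complete a) (points-complete b)

  design : List (Subspace (k + k))
  design = graphs List.++ sections

  -- Over 𝔽₂ the vectors x₁ and x₂ are independent unless one is zero or they agree. In the latter
  -- cases both are multiples of one nonzero Q, or both are zero and the pair lies in S.
  design-covers : ∀ x₁ s₁ x₂ s₂ → Any (CoversPair (x₁ ++ s₁) (x₂ ++ s₂)) design
  design-covers x₁ s₁ x₂ s₂ with x₁ ≟ᵥ 𝟎 | x₂ ≟ᵥ 𝟎 | x₁ ≟ᵥ x₂
  ... | yes refl | yes refl | _ = Any.++⁺ʳ graphs (sections-cover-vertical s₁ s₂)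
  ... | yes refl | no x₂≢𝟎 | _ = Any.++⁺ʳ graphs
    (subst₂ (λ y₁ y₂ → Any (CoversPair (y₁ ++ s₁) (y₂ ++ s₂)) sections) (·-zeroˡ x₂) (·-identityˡ x₂)
      (sections-cover-collinear x₂ x₂≢𝟎 false true (λ ()) s₁ s₂))
  ... | no x₁≢𝟎 | yes refl | _ = Any.++⁺ʳ graphs
    (subst₂ (λ y₁ y₂ → Any (CoversPair (y₁ ++ s₁) (y₂ ++ s₂)) sections) (·-identityˡ x₁) (·-zeroˡ x₁)
      (sections-cover-collinear x₁ x₁≢𝟎 true false (λ ()) s₁ s₂))
  ... | no x₁≢𝟎 | no _ | yes refl = Any.++⁺ʳ graphs
    (subst (λ y → Any (CoversPair (y ++ s₁) (y ++ s₂)) sections) (·-identityˡ x₁)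
      (sections-cover-collinear x₁ x₁≢𝟎 true true (λ ()) s₁ s₂))
  ... | no x₁≢𝟎 | no x₂≢𝟎 | no x₁≢x₂ = Any.++⁺ˡ (graphs-cover x₁≢𝟎 x₂≢𝟎 x₁≢x₂ s₁ s₂)

  design-isCoveringDesign : IsCoveringDesign₂ (k + k) k 2 design
  design-isCoveringDesign = record
    { dimension = All.++⁺ graphs-dimension sections-dimension
    ; covering  = pairs⇒covering covers
    }
    where
    covers : ∀ w₁ w₂ → LinearlyIndependent (w₁ ∷ w₂ ∷ []) → Any (CoversPair w₁ w₂) design
    covers w₁ w₂ _ with Vec.splitAt k w₁ | Vec.splitAt k w₂
    ... | x₁ , s₁ , refl | x₂ , s₂ , refl = design-covers x₁ s₁ x₂ s₂

  length-design : length design ≡ 2 ^ (k + k) + 6 * (2 ^ k ∸ 1)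
  length-design = begin
    length (graphs List.++ sections)                                      ≡⟨ List.length-++ graphs ⟩
    length graphs + length (sections {j})                                 ≡⟨ cong₂ _+_ length-graphs (length-sections {j}) ⟩
    length (points k) * length (points k) + length (nonzeroPoints k) * 6  ≡⟨ cong₂ _+_ (cong₂ _*_ (length-vectors bits k) (length-vectors bits k)) (ℕ.*-comm (length (nonzeroPoints k)) 6) ⟩
    2 ^ k * 2 ^ k + 6 * length (nonzeroPoints k)                          ≡⟨ cong₂ _+_ (ℕ.^-distribˡ-+-* 2 k k) (cong (λ n → 6 * (n ∸ 1)) (sym (length-nonzeroPoints k))) ⟨
    2 ^ (k + k) + 6 * (2 ^ k ∸ 1)                                         ∎
    where open ≡-Reasoning

mainTheorem7 : ∀ (k : ℕ) → 3 ≤ k →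
    ∃[ m ] IsCoveringNumber₂ (2 * k) k 2 m × m ≤ 2 ^ (2 * k) + 6 * (2 ^ k ∸ 1)
mainTheorem7 k@(suc (suc (suc j))) (s≤s (s≤s (s≤s z≤n))) =
  subst (λ n → ∃[ m ] IsCoveringNumber₂ n k 2 m × m ≤ 2 ^ n + 6 * (2 ^ k ∸ 1))
    (cong (k +_) (sym (ℕ.+-identityʳ k)))
    -- Here κ = j + 2 is k - 1, so the field has 2^(κ+1) = 2^k elements.
    (let open GaloisField _ _ (proj₂ (galoisField (suc (suc j))))
         open CoveringDesign linearizedᵥ linearizedᵥ-⊕ linearizedᵥ-interpolate
         m , isCoveringNumber , m≤ = coveringNumber design design-isCoveringDesign
     in m , isCoveringNumber , subst (m ≤_) length-design m≤)
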